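{- Let $p$ be an odd prime, $s\ge 2$ and $m\ge1$ integers, $R$ the Galois ring of characteristic $p^{s}$ and cardinality $p^{sm}$, $\nu\ge 2$ an integer and $\delta\in\{0,1,2\}$. Then the orthogonal graph $\Gamma^{2\nu+\delta}$ is quasi-strongly regular with parameters $(n,k,\lambda;c_1,c_2)$, where $$n=\frac{(p^{m\nu}-1)(p^{m(\nu+\delta-1)}+1)p^{m(s-1)(2\nu-2+\delta)}}{p^{m}-1},\qquad k=p^{ms(2\nu-2+\delta)},$$ $$\lambda=(p^{m}-1)\bigl(1+(\delta-1)p^{m(1-\nu-\frac{\delta}{2})}\bigr)p^{m(2s\nu-2s-1+s\delta)},\quad c_1=(p^{m}-1)p^{m(s(2\nu-2+\delta)-1)},\quad c_2=p^{ms(2\nu-2+\delta)}.$$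
   Context: $R$ is a finite local ring with maximal ideal $pR$ and residue field of order $p^{m}$; $R^{*}$ is its unit group and $z$ a fixed non-square element of $R^{*}$. Vectors of length $2\nu+\delta$ over $R$ having some unit coordinate are considered up to multiplication by units; $[a_1,\dots,a_{2\nu+\delta}]$ denotes the class. Let $S=\begin{pmatrix}0&I^{(\nu)}&0\\ I^{(\nu)}&0&0\\0&0&\Delta\end{pmatrix}$ with $\Delta$ absent if $\delta=0$, $\Delta=(1)$ or $(z)$ (one fixed choice) if $\delta=1$, $\Delta=\mathrm{diag}(1,-z)$ if $\delta=2$. The orthogonal graph $\Gamma^{2\nu+\delta}$ has vertices the classes $[\alpha]$ with $\alpha S\alpha^{t}=0$, and $[\alpha]\sim[\beta]$ iff $\alpha S\beta^{t}\in R^{*}$. For distinct non-negative integers $c_1,\dots,c_d$, a connected $k$-regular graph on $n$ vertices is quasi-strongly regular with parameters $(n,k,\lambda;c_1,\dots,c_d)$ if any two adjacent vertices have exactly $\lambda$ common neighbours and any two distinct non-adjacent vertices have exactly $c_i$ common neighbours for some $i$. The paper's standing assumption is $s\ge2$. -}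

module Defs where

open import Level using (Level; _⊔_) renaming (suc to lsuc)
open import Algebra.Bundles using (CommutativeRing)
import Algebra.Definitions.RawMonoid as RawMonoidDefs
open import Data.Nat using (ℕ; zero; suc; _+_; _*_; _∸_; _^_; _≤_; _<_; _≥_; _/_; NonZero; _<ᵇ_; _≡ᵇ_)
open import Data.Nat.Base using (>-nonZero; nonTrivial⇒n>1)
open import Data.Nat.Properties using (m<n⇒0<n∸m; *-mono-≤; m^n>0)
open import Data.Nat.Primality using (Prime; prime⇒nonTrivial; prime⇒nonZero)
open import Data.Bool using (Bool; true; false; if_then_else_; _∧_; _∨_)
open import Data.Fin using (Fin; toℕ)
open import Data.List using (List; length)
open import Data.List.Relation.Unary.All using (All)
open import Data.List.Relation.Unary.Any using (Any)
open import Data.List.Relation.Unary.AllPairs using (AllPairs)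
open import Data.Product using (Σ; ∃; _×_; _,_)
open import Data.Sum using (_⊎_)
open import Data.Unit.Polymorphic using (⊤)
open import Relation.Nullary using (¬_)
open import Relation.Binary.PropositionalEquality using (_≡_; _≢_)
open import Function.Bundles using (_⇔_)

-- Counting up to an equivalence relation.
-- HasCount _~_ P n : the elements satisfying P fall into exactly n
-- classes modulo _~_ (witnessed by a complete, irredundant list of
-- representatives of length n).

HasCount : ∀ {a r q} {A : Set a} (_~_ : A → A → Set r) (P : A → Set q) (n : ℕ) →
           Set (a ⊔ r ⊔ q)
HasCount {A = A} _~_ P n =
  Σ (List A) λ L →
    All P L
    × AllPairs (λ x y → ¬ (x ~ y)) L
    × (∀ x → P x → Any (λ y → x ~ y) L)
    × length L ≡ n

-- Graphs whose vertices are the classes of the elements satisfying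
-- Vtx modulo _~_, adjacency given by Adj (compatible with _~_).

data Path {a r e} {A : Set a} (Vtx : A → Set e) (_~_ : A → A → Set r) (Adj : A → A → Set r) :
          A → A → Set (a ⊔ r ⊔ e) where
  here  : ∀ {x y} → x ~ y → Path Vtx _~_ Adj x y
  there : ∀ {x w y} → Adj x w → Vtx w → Path Vtx _~_ Adj w y → Path Vtx _~_ Adj x y

record QuasiStronglyRegular {a r e} {A : Set a} (Vtx : A → Set e)
         (_~_ : A → A → Set r) (Adj : A → A → Set r)
         (n k lam c₁ c₂ : ℕ) : Set (a ⊔ r ⊔ e) where
  field
    c-distinct : c₁ ≢ c₂
    order      : HasCount _~_ Vtx n
    connected  : ∀ x y → Vtx x → Vtx y → Path Vtx _~_ Adj x y
    regular    : ∀ x → Vtx x → HasCount _~_ (λ y → Vtx y × Adj x y) k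
    adjacent   : ∀ x y → Vtx x → Vtx y → ¬ (x ~ y) → Adj x y →
                 HasCount _~_ (λ w → Vtx w × Adj x w × Adj y w) lam
    nonadjacent : ∀ x y → Vtx x → Vtx y → ¬ (x ~ y) → ¬ Adj x y →
                  HasCount _~_ (λ w → Vtx w × Adj x w × Adj y w) c₁
                  ⊎ HasCount _~_ (λ w → Vtx w × Adj x w × Adj y w) c₂

module RingNotions {c ℓ : Level} (R : CommutativeRing c ℓ) where
  open CommutativeRing R renaming (_*_ to _*ᴿ_; _+_ to _+ᴿ_)
  open RawMonoidDefs +-rawMonoid using () renaming (_×_ to _·ℕ_)

  natR : ℕ → Carrier
  natR n = n ·ℕ 1#

  Unit : Carrier → Set (c ⊔ ℓ)
  Unit x = ∃ λ y → x *ᴿ y ≈ 1#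

  NonSquareUnit : Carrier → Set (c ⊔ ℓ)
  NonSquareUnit z = Unit z × ¬ (∃ λ y → y *ᴿ y ≈ z)

  -- R is the Galois ring of characteristic p^s and cardinality p^(s m):
  -- a finite commutative local ring whose maximal ideal (= set of
  -- non-units) is pR, of characteristic p^s and with p^(s m) elements.
  record GaloisRing (p s m : ℕ) : Set (c ⊔ ℓ) where
    field
      char-zero    : natR (p ^ s) ≈ 0#
      char-minimal : ∀ k → 0 < k → k < p ^ s → ¬ (natR k ≈ 0#)
      cardinality  : HasCount _≈_ (λ (_ : Carrier) → ⊤ {ℓ}) (p ^ (s * m))
      maximal-pR   : ∀ x → (¬ Unit x) ⇔ (∃ λ y → x ≈ natR p *ᴿ y)

module Orthogonal {c ℓ : Level} (R : CommutativeRing c ℓ)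
                  (ν δ : ℕ) (z : CommutativeRing.Carrier R) (useZ : Bool) where
  open CommutativeRing R renaming (_*_ to _*ᴿ_; _+_ to _+ᴿ_)
  open RingNotions R using (Unit)
  open RawMonoidDefs +-rawMonoid using (sum)

  N : ℕ
  N = 2 * ν + δ

  Vector : Set c
  Vector = Fin N → Carrier

  -- Δ = (1) or (z) (chosen by useZ) if δ = 1, Δ = diag(1, -z) if δ = 2
  Δentry : ℕ → ℕ → Carrier
  Δentry 1 0 = if useZ then z else 1#
  Δentry 2 0 = 1#
  Δentry 2 1 = - z
  Δentry _ _ = 0#

  -- the matrix S = [[0, I, 0], [I, 0, 0], [0, 0, Δ]]
  S : Fin N → Fin N → Carrier
  S i j =
    let a = toℕ i ; b = toℕ j in
    if (a <ᵇ 2 * ν) ∧ (b <ᵇ 2 * ν)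
      then (if ((a + ν) ≡ᵇ b) ∨ ((b + ν) ≡ᵇ a) then 1# else 0#)
      else (if a ≡ᵇ b then Δentry δ (a ∸ 2 * ν) else 0#)

  form : Vector → Vector → Carrier
  form α β = sum (λ i → sum (λ j → α i *ᴿ S i j *ᴿ β j))

  HasUnitCoord : Vector → Set (c ⊔ ℓ)
  HasUnitCoord α = ∃ λ i → Unit (α i)

  Vertex : Vector → Set (c ⊔ ℓ)
  Vertex α = HasUnitCoord α × form α α ≈ 0#

  _~_ : Vector → Vector → Set (c ⊔ ℓ)
  α ~ β = ∃ λ u → Unit u × (∀ i → β i ≈ u *ᴿ α i)

  Adj : Vector → Vector → Set (c ⊔ ℓ)
  Adj α β = Unit (form α β)

pm-1-nonZero : ∀ p m → Prime p → m ≥ 1 → NonZero (p ^ m ∸ 1)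
pm-1-nonZero p (suc b) pr _ =
  >-nonZero (m<n⇒0<n∸m (*-mono-≤ (nonTrivial⇒n>1 p {{prime⇒nonTrivial pr}})
                                  (m^n>0 p {{prime⇒nonZero pr}} b)))

nParam : (p s m ν δ : ℕ) → Prime p → m ≥ 1 → ℕ
nParam p s m ν δ pr m≥1 =
  _/_ ((p ^ (m * ν) ∸ 1) * (p ^ (m * (ν + δ ∸ 1)) + 1) * p ^ (m * (s ∸ 1) * (2 * ν + δ ∸ 2)))
      (p ^ m ∸ 1) {{pm-1-nonZero p m pr m≥1}}

kParam : (p s m ν δ : ℕ) → ℕ
kParam p s m ν δ = p ^ (m * s * (2 * ν + δ ∸ 2))

-- λ = (p^m-1)(1+(δ-1)p^{m(1-ν-δ/2)}) p^{m(2sν-2s-1+sδ)}, with the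
-- product expanded for each δ so that all exponents are natural numbers.
lamParam : (p s m ν δ : ℕ) → ℕ
lamParam p s m ν 0 =
  (p ^ m ∸ 1) * (p ^ (m * (s * (2 * ν ∸ 2) ∸ 1)) ∸ p ^ (m * ((2 * s ∸ 1) * ν ∸ 2 * s)))
lamParam p s m ν 1 =
  (p ^ m ∸ 1) * p ^ (m * (s * (2 * ν ∸ 1) ∸ 1))
lamParam p s m ν 2 =
  (p ^ m ∸ 1) * (p ^ (m * (s * (2 * ν) ∸ 1)) + p ^ (m * (2 * s * ν ∸ 1 ∸ ν)))
lamParam p s m ν _ = 0

c₁Param : (p s m ν δ : ℕ) → ℕ
c₁Param p s m ν δ = (p ^ m ∸ 1) * p ^ (m * (s * (2 * ν + δ ∸ 2) ∸ 1))

c₂Param : (p s m ν δ : ℕ) → ℕ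
c₂Param p s m ν δ = p ^ (m * s * (2 * ν + δ ∸ 2))

{-# OPTIONS --safe #-}
module Submission where

open import Defs
open import Algebra.Bundles using (CommutativeRing; RawRing)
open import Algebra.Solver.Ring.AlmostCommutativeRing using (fromCommutativeRing; _-Raw-AlmostCommutative⟶_)
import Algebra.Solver.Ring as Solver
open import Data.Bool using (Bool; true; false; T; if_then_else_; _∧_; _∨_)
open import Data.Bool.Properties using (T-∧; T-∨; T?)
open import Data.Empty using (⊥-elim)
open import Data.Fin using (Fin; zero; suc; toℕ; _↑ˡ_; _↑ʳ_; splitAt)
open import Data.Fin.Properties using (toℕ-↑ˡ; toℕ-↑ʳ; toℕ-injective; toℕ<n; splitAt⁻¹-↑ˡ; splitAt⁻¹-↑ʳ; all?; any?; injective⇒≤) renaming (_≟_ to _≟ᶠ_)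
open import Data.List using (List; []; _∷_; length; map; _++_; filter; deduplicate; lookup)
open import Data.List.Membership.Propositional.Properties using (∈-lookup)
open import Data.List.Properties using (length-map; length-++)
open import Data.List.Relation.Unary.All as All using (All; []; _∷_)
import Data.List.Relation.Unary.All.Properties as Allₚ
open import Data.List.Relation.Unary.AllPairs using (AllPairs; []; _∷_)
import Data.List.Relation.Unary.AllPairs.Properties as AllPairsₚ
open import Data.List.Relation.Unary.Any as Any using (Any; here; there)
import Data.List.Relation.Unary.Any.Properties as Anyₚ
open import Data.List.Relation.Unary.Unique.DecSetoid.Properties using (deduplicate-!)
open import Data.Maybe using (Maybe; just; nothing)
open import Data.Nat as ℕ using (ℕ; zero; suc; _<_; _≤_; _≥_; _<ᵇ_; _≡ᵇ_; s≤s; NonZero)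
import Data.Nat.DivMod as ℕ
import Data.Nat.Divisibility as ℕ
open import Data.Nat.Primality using (Prime; prime⇒nonZero; prime⇒nonTrivial; prime⇒irreducible)
import Data.Nat.Properties as ℕₚ
open import Data.Nat.Tactic.RingSolver using (solve-∀)
open import Data.Product using (∃; _×_; _,_; proj₁; proj₂)
open import Data.Product.Relation.Binary.Pointwise.NonDependent using (_×ₛ_)
open import Data.Sum using (_⊎_; inj₁; inj₂; [_,_]′) renaming (map to map-⊎)
import Data.Vec.Functional as Vector
open import Data.Vec.Functional.Properties using (lookup-++ˡ; lookup-++ʳ)
open import Function using (_∘_; id; Equivalence)
open import Level using (Level; _⊔_; 0ℓ) renaming (suc to lsuc)
open import Relation.Binary using (Rel; Setoid; IsEquivalence; _Respects_; tri<; tri≈; tri>)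
open import Relation.Binary.PropositionalEquality as ≡ using (_≡_; _≢_)
open import Relation.Nullary using (¬_; Dec; yes; no; ¬?; _×-dec_)
open import Relation.Nullary.Decidable using (decidable-stable; map′)
open import Relation.Unary using (Decidable; U)

-- Counting isotropic vectors reduces to translating along suitable directions: if a set of vectors
-- is closed under v ↦ v + t d and a function g satisfies g (v + t d) = g v + t on it, then the part
-- where g takes values in X is |X| times the part where g vanishes. Write B for the form, Q v = B v v,
-- and let x be a vertex. A neighbour of x is normalised by B x v = 1, and translating along x changes
-- Q v / 2 by t, which gives the degree. If x and y are non-adjacent and independent modulo p, then
-- B y v being a unit is unaffected by the translation along x, which gives c₁; if they are dependent
-- modulo p, they have the same neighbours, which gives c₂.
--
-- If B x y = 1, the neighbours v of x with B y v a non-unit are counted, by translations along y and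
-- x, in terms of the number of all vectors v with Q v a non-unit. That number does not depend on x
-- and y, and splitting off hyperbolic planes from the standard form down to the anisotropic part Δ
-- gives a recursion for it, and likewise one for the number of primitive isotropic vectors, which is
-- the number of vertices times the number of units.

-- Let `B x y = 1`. A vector with `B x v = 1` is `y + b x + w` with `w` orthogonal to `x` and `y`;
-- isotropy forces `b = - Q w / 2`, and `B y v = b`. Hence λ is the number of `w` in the complement
-- of the plane for which `Q w` is a unit. Reading this off directly would require an isometry
-- between that complement and the standard form of smaller rank, which is Witt cancellation over
-- the ring. This is avoided by counting one and the same set, the vectors `v` of the whole space
-- with `Q v` a non-unit, in two ways: standard coordinates express its size through the
-- corresponding number `t` for one plane fewer, and translations along the given `x` and `y` then
-- isolate that `t` without any description of the complement. The recursion for primitive isotropic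
-- vectors does not close on the equation `Q = 0`, so it treats all equations `Q = c` with a
-- non-unit `c` at once. It starts from the anisotropy of Δ modulo `p`; for `diag(1, -z)` this needs
-- that a non-square unit stays a non-square modulo `p`, which is Hensel's lemma.

module Counting where
  -- `HasCount` unfolds to a Σ-type, from which the equivalence and the predicate are hard to
  -- recover by unification; the record keeps them visible as parameters.
  record Count {a r q} (A : Setoid a r) (P : Setoid.Carrier A → Set q) (n : ℕ) : Set (a ⊔ r ⊔ q) where
    constructor mkCount
    field hasCount : HasCount (Setoid._≈_ A) P n
  open Count

  private
    variable
      a b q q′ r r′ : Level
      k m n : ℕ

    lookup-separates : {A : Set a} {_~_ : Rel A r} → (∀ {x y} → x ~ y → y ~ x) →
      ∀ {xs} → AllPairs (λ x y → ¬ (x ~ y)) xs →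
      ∀ i j → lookup xs i ~ lookup xs j → i ≡ j
    lookup-separates sym (_ ∷ _)   zero    zero    _ = ≡.refl
    lookup-separates sym (≁x ∷ _)  zero    (suc j) e = ⊥-elim (All.lookup ≁x (∈-lookup j) e)
    lookup-separates sym (≁x ∷ _)  (suc i) zero    e = ⊥-elim (All.lookup ≁x (∈-lookup i) (sym e))
    lookup-separates sym (_ ∷ sep) (suc i) (suc j) e = ≡.cong suc (lookup-separates sym sep i j e)

  module _ {A : Setoid a r} where
    open Setoid A renaming (Carrier to ∣A∣; refl to ≈-refl; sym to ≈-sym; trans to ≈-trans)

    -- Pigeonhole: sending each entry of `xs` to the index of a related entry of `ys` is injective
    -- because `xs` is separated. That a predicate determines its count rests on this.
    separated⇒length≤ : ∀ {xs ys : List ∣A∣} → AllPairs (λ x y → ¬ (x ≈ y)) xs →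
      All (λ x → Any (x ≈_) ys) xs → length xs ≤ length ys
    separated⇒length≤ {xs} {ys} sep cover = injective⇒≤ {f = λ i → Any.index (covered i)} λ {i} {j} e →
      lookup-separates ≈-sym sep i j
        (≈-trans (Anyₚ.lookup-index (covered i))
          (≈-trans (reflexive (≡.cong (lookup ys) e)) (≈-sym (Anyₚ.lookup-index (covered j)))))
      where
      covered : ∀ i → Any (lookup xs i ≈_) ys
      covered i = All.lookup cover (∈-lookup i)

    count-mono : {P : ∣A∣ → Set q} {Q : ∣A∣ → Set q′} →
      (∀ x → P x → Q x) → Count A P m → Count A Q n → m ≤ n
    count-mono P⇒Q (mkCount (_ , ps , sep , _ , ≡.refl)) (mkCount (_ , _ , _ , cover , ≡.refl)) =
      separated⇒length≤ sep (All.map (λ px → cover _ (P⇒Q _ px)) ps)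

    count-unique : {P : ∣A∣ → Set q} → Count A P m → Count A P n → m ≡ n
    count-unique c d = ℕₚ.≤-antisym (count-mono (λ _ → id) c d) (count-mono (λ _ → id) d c)

    count-cong : {P : ∣A∣ → Set q} {Q : ∣A∣ → Set q′} →
      (∀ x → P x → Q x) → (∀ x → Q x → P x) → Count A P n → Count A Q n
    count-cong P⇒Q Q⇒P (mkCount (xs , ps , sep , cover , len)) =
      mkCount (xs , All.map (P⇒Q _) ps , sep , (λ x qx → cover x (Q⇒P x qx)) , len)

    count-∅ : {P : ∣A∣ → Set q} → (∀ x → ¬ P x) → Count A P 0
    count-∅ ¬P = mkCount ([] , [] , [] , (λ x px → ⊥-elim (¬P x px)) , ≡.refl)

    count-one : {P : ∣A∣ → Set q} → ∀ x → P x → (∀ y → P y → y ≈ x) → Count A P 1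
    count-one x px only = mkCount (x ∷ [] , px ∷ [] , [] ∷ [] , (λ y py → here (only y py)) , ≡.refl)

    count-witness : {P : ∣A∣ → Set q} → Count A P (suc n) → ∃ P
    count-witness (mkCount (x ∷ _ , px ∷ _ , _)) = x , px

    count-inhabited : {P : ∣A∣ → Set q} .{{_ : NonZero n}} → Count A P n → ∃ P
    count-inhabited {n = suc _} = count-witness

    count-nonZero : {P : ∣A∣ → Set q} → ∀ x → P x → Count A P n → NonZero n
    count-nonZero x px (mkCount (_ ∷ _ , _ , _ , _ , ≡.refl)) = _
    count-nonZero x px (mkCount ([] , _ , _ , cover , ≡.refl)) with () ← cover x px

    count-⊎ : {P : ∣A∣ → Set q} {Q : ∣A∣ → Set q′} →
      (∀ {x y} → P x → Q y → ¬ (x ≈ y)) →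
      Count A P m → Count A Q n → Count A (λ x → P x ⊎ Q x) (m ℕ.+ n)
    count-⊎ P#Q (mkCount (xs , ps , sep , cover , ≡.refl)) (mkCount (ys , qs , sep′ , cover′ , ≡.refl)) =
      mkCount (xs ++ ys
        , Allₚ.++⁺ (All.map inj₁ ps) (All.map inj₂ qs)
        , AllPairsₚ.++⁺ sep sep′ (All.map (λ px → All.map (P#Q px) qs) ps)
        , (λ { x (inj₁ px) → Anyₚ.++⁺ˡ (cover x px) ; x (inj₂ qx) → Anyₚ.++⁺ʳ xs (cover′ x qx) })
        , length-++ xs)

    count-split : {P : ∣A∣ → Set q} {E : ∣A∣ → Set q′} → Decidable E → E Respects _≈_ →
      Count A (λ x → P x × E x) m → Count A (λ x → P x × ¬ E x) n → Count A P (m ℕ.+ n)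
    count-split {P = P} {E} E? resp c d =
      count-cong (λ { _ (inj₁ (px , _)) → px ; _ (inj₂ (px , _)) → px }) classify
        (count-⊎ (λ (_ , ex) (_ , ¬ey) x≈y → ¬ey (resp x≈y ex)) c d)
      where
      classify : ∀ x → P x → (P x × E x) ⊎ (P x × ¬ E x)
      classify x px with E? x
      ... | yes ex = inj₁ (px , ex)
      ... | no ¬ex = inj₂ (px , ¬ex)

    -- Abstract, so that cardinalities are compared without evaluating the enumerations.
    abstract
      count-filter : {P : ∣A∣ → Set q} {E : ∣A∣ → Set q′} → Decidable E → E Respects _≈_ →
        Count A P n → ∃ (Count A (λ x → P x × E x))
      count-filter {P = P} {E} E? resp (mkCount (xs , ps , sep , cover , _)) =
        _ , mkCount (filter E? xs , Allₚ.filter⁺ E? ps ⊗ Allₚ.all-filter E? xs , AllPairsₚ.filter⁺ E? sep , covers , ≡.refl)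
        where
        _⊗_ : ∀ {xs} → All P xs → All E xs → All (λ x → P x × E x) xs
        ps ⊗ es = All.zip (ps , es)
        covers : ∀ x → P x × E x → Any (x ≈_) (filter E? xs)
        covers x (px , ex) with Anyₚ.filter⁺ E? (cover x px)
        ... | inj₁ found = found
        ... | inj₂ ¬e    = ⊥-elim (¬e (resp (Anyₚ.lookup-result (cover x px)) ex))

      count-∖ : {P : ∣A∣ → Set q} {E : ∣A∣ → Set q′} → Decidable E → E Respects _≈_ →
        Count A P n → Count A (λ x → P x × E x) m →
        ∃ λ k → Count A (λ x → P x × ¬ E x) k × m ℕ.+ k ≡ n
      count-∖ E? resp c d with count-filter (λ x → ¬? (E? x)) (λ x≈y ¬ex ey → ¬ex (resp (≈-sym x≈y) ey)) c
      ... | k , c′ = k , c′ , count-unique (count-split E? resp d c′) c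

    count-any? : {P : ∣A∣ → Set q} {E : ∣A∣ → Set q′} → Decidable E → E Respects _≈_ →
      Count A P n → Dec (∃ λ x → P x × E x)
    count-any? E? resp c with count-filter E? resp c
    ... | zero  , mkCount ([] , _ , _ , cover , _) = no λ (x , pe) → Anyₚ.¬Any[] (cover x pe)
    ... | suc _ , c′ = yes (count-witness c′)

    count-≟ : {P : ∣A∣ → Set q} → Count A P n → ∀ {x y} → P x → P y → Dec (x ≈ y)
    count-≟ (mkCount (xs , _ , sep , cover , _)) {x} {y} px py
      with Any.index (cover x px) ≟ᶠ Any.index (cover y py)
    ... | yes e = yes (≈-trans (Anyₚ.lookup-index (cover x px))
                   (≈-trans (reflexive (≡.cong (lookup xs) e)) (≈-sym (Anyₚ.lookup-index (cover y py)))))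
    ... | no ≢  = no λ x≈y → ≢ (lookup-separates ≈-sym sep _ _
                   (≈-trans (≈-sym (Anyₚ.lookup-index (cover x px)))
                     (≈-trans x≈y (Anyₚ.lookup-index (cover y py)))))

  module _ {A : Setoid a r} {B : Setoid b r′} where
    private
      module A = Setoid A
      module B = Setoid B

    count-map : {P : A.Carrier → Set q} {Q : B.Carrier → Set q′} (f : A.Carrier → B.Carrier) →
      (∀ {x y} → x A.≈ y → f x B.≈ f y) →
      (∀ x → P x → Q (f x)) →
      (∀ {x y} → P x → P y → f x B.≈ f y → x A.≈ y) →
      (∀ y → Q y → ∃ λ x → P x × y B.≈ f x) →
      Count A P n → Count B Q n
    count-map {P = P} f f-cong P⇒Q f-inj f-surj (mkCount (xs , ps , sep , cover , len)) =
      mkCount (map f xs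
        , Allₚ.map⁺ (All.map (P⇒Q _) ps)
        , AllPairsₚ.map⁺ (separated ps sep)
        , (λ y qy → let x , px , y≈fx = f-surj y qy in
             Anyₚ.map⁺ (Any.map (λ x≈x′ → B.trans y≈fx (f-cong x≈x′)) (cover x px)))
        , ≡.trans (length-map f xs) len)
      where
      separated : ∀ {xs} → All P xs → AllPairs (λ x y → ¬ (x A.≈ y)) xs →
        AllPairs (λ x y → ¬ (f x B.≈ f y)) xs
      separated []        []          = []
      separated (px ∷ ps) (≁x ∷ sep) =
        All.zipWith (λ (py , x≉y) fx≈fy → x≉y (f-inj px py fx≈fy)) (ps , ≁x) ∷ separated ps sep

    count-fibres : {P : A.Carrier → Set q} {Q : B.Carrier → Set q′} (g : B.Carrier → A.Carrier) →
      (∀ {x y} → x B.≈ y → g x A.≈ g y) →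
      (∀ y → Q y → P (g y)) →
      (∀ x → P x → Count B (λ y → Q y × g y A.≈ x) m) →
      Count A P n → Count B Q (n ℕ.* m)
    count-fibres {m = m} {P = P} {Q = Q} g g-cong Q⇒P fibre (mkCount (xs , ps , sep , cover , ≡.refl)) =
      count-cong (λ _ → proj₁) (λ y qy → qy , cover (g y) (Q⇒P y qy)) (over ps sep)
      where
      over : ∀ {xs} → All P xs → AllPairs (λ x y → ¬ (x A.≈ y)) xs →
        Count B (λ y → Q y × Any (g y A.≈_) xs) (length xs ℕ.* m)
      over []        []         = count-∅ (λ { _ (_ , ()) })
      over (px ∷ ps) (≁x ∷ sep) =
        count-cong (λ { _ (inj₁ (qy , e)) → qy , here e ; _ (inj₂ (qy , e)) → qy , there e })
                   (λ { _ (qy , here e) → inj₁ (qy , e) ; _ (qy , there e) → inj₂ (qy , e) })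
          (count-⊎ (λ (_ , gy≈x) (_ , any) y≈y′ → Allₚ.All¬⇒¬Any ≁x
                      (Any.map (A.trans (A.trans (A.sym gy≈x) (g-cong y≈y′))) any))
            (fibre _ px) (over ps sep))

  module _ {A : Setoid a r} {B : Setoid b r′} where
    private
      module A = Setoid A
      module B = Setoid B

    count-Σ : {P : A.Carrier → Set q} {Q : A.Carrier → B.Carrier → Set q′} →
      (∀ {x x′ y} → x A.≈ x′ → Q x y → Q x′ y) →
      Count A P n → (∀ x → P x → Count B (Q x) m) →
      Count (A ×ₛ B) (λ (x , y) → P x × Q x y) (n ℕ.* m)
    count-Σ resp c d = count-fibres proj₁ proj₁ (λ _ → proj₁)
      (λ x px → count-map (x ,_) (A.refl ,_) (λ _ qy → (px , qy) , A.refl) (λ _ _ → proj₂)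
         (λ (_ , y) ((_ , qy) , x′≈x) → y , resp x′≈x qy , x′≈x , B.refl) (d x px))
      c

    count-× : {P : A.Carrier → Set q} {Q : B.Carrier → Set q′} →
      Count A P n → Count B Q m → Count (A ×ₛ B) (λ (x , y) → P x × Q y) (n ℕ.* m)
    count-× c d = count-Σ (λ _ qy → qy) c (λ _ _ → d)

  module _ {A : Setoid a r} where
    open Setoid A renaming (Carrier to ∣A∣; refl to ≈-refl; sym to ≈-sym; trans to ≈-trans)

    abstract
      count-quotient : {P : ∣A∣ → Set q} {_~_ : Rel ∣A∣ r′} (~-equiv : IsEquivalence _~_) →
        (∀ x y → Dec (x ~ y)) → (∀ {x y} → x ≈ y → x ~ y) →
        Count A P n → ∃ (Count (record { isEquivalence = ~-equiv }) P)
      count-quotient ~-equiv _~?_ ≈⇒~ (mkCount (xs , ps , _ , cover , _)) =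
        _ , mkCount (deduplicate _~?_ xs
              , Allₚ.deduplicate⁺ _~?_ ps
              , deduplicate-! (record { isDecEquivalence = record { isEquivalence = ~-equiv ; _≟_ = _~?_ } }) xs
              , (λ x px → Anyₚ.deduplicate⁺ _~?_ (λ y~z x~z → ~.trans x~z (~.sym y~z)) (Any.map ≈⇒~ (cover x px)))
              , ≡.refl)
        where module ~ = IsEquivalence ~-equiv

    -- If `y` were missed, the image of `f`, which again has `n` classes, would together with `y`
    -- give `n + 1` classes inside `P`.
    injective⇒surjective : {P : ∣A∣ → Set q} → (∀ x y → Dec (x ≈ y)) → P Respects _≈_ → Count A P n →
      (f : ∣A∣ → ∣A∣) → (∀ {x y} → x ≈ y → f x ≈ f y) → (∀ x → P x → P (f x)) →
      (∀ {x y} → P x → P y → f x ≈ f y → x ≈ y) →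
      ∀ y → P y → ∃ λ x → P x × f x ≈ y
    injective⇒surjective {n = n} {P = P} _≟_ resp c f f-cong P⇒P f-inj y py
      with count-any? (λ x → f x ≟ y) (λ x≈x′ e → ≈-trans (f-cong (≈-sym x≈x′)) e) c
    ... | yes found = found
    ... | no  none  = ⊥-elim (ℕₚ.1+n≰n (≡.subst (_≤ n) (ℕₚ.+-comm n 1) (count-mono inP extended c)))
      where
      image : Count A (λ y′ → ∃ λ x → P x × y′ ≈ f x) n
      image = count-map f f-cong (λ x px → x , px , ≈-refl) f-inj (λ _ → id) c
      extended : Count A (λ y′ → (∃ λ x → P x × y′ ≈ f x) ⊎ y′ ≈ y) (n ℕ.+ 1)
      extended = count-⊎ (λ (x , px , e) e′ e″ → none (x , px , ≈-trans (≈-sym e) (≈-trans e″ e′)))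
                   image (count-one y ≈-refl (λ _ → id))
      inP : ∀ y′ → (∃ λ x → P x × y′ ≈ f x) ⊎ y′ ≈ y → P y′
      inP y′ (inj₁ (x , px , e)) = resp (≈-sym e) (P⇒P x px)
      inP y′ (inj₂ e)            = resp (≈-sym e) py

open Counting

-- A ring solver with integer coefficients over an arbitrary commutative ring

module RingSolver {c ℓ} (R : CommutativeRing c ℓ) where
  open CommutativeRing R
  open import Algebra.Properties.Semiring.Mult semiring using (×-homo-+; ×1-homo-*) renaming (_×_ to _·_)
  open import Algebra.Properties.Semiring.Mult.TCOptimised semiring using (×ᵤ≈×) renaming (_×_ to _·′_)
  open import Algebra.Properties.AbelianGroup +-abelianGroup using (⁻¹-∙-comm; ⁻¹-involutive)
  open import Algebra.Properties.Ring ring using (-‿distribˡ-*; -‿distribʳ-*; -0#≈0#)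
  open import Relation.Binary.Reasoning.Setoid setoid

  import Algebra.Solver.Ring.NaturalCoefficients.Default commutativeSemiring as SR

  -- Coefficients are formal differences of naturals; the clauses of ⟦_⟧ make
  -- 0#, 1# and 1# + 1# definitional values.
  ⟦_⟧ : ℕ × ℕ → Carrier
  ⟦ m , zero ⟧    = m ·′ 1#
  ⟦ m , n@(suc _) ⟧ = m ·′ 1# - n ·′ 1#

  ⟦⟧≈ : ∀ m n → ⟦ m , n ⟧ ≈ m · 1# - n · 1#
  ⟦⟧≈ m zero    = begin
    m ·′ 1#       ≈⟨ ×ᵤ≈× m 1# ⟨
    m · 1#        ≈⟨ +-identityʳ _ ⟨
    m · 1# + 0#   ≈⟨ +-congˡ -0#≈0# ⟨
    m · 1# - 0#   ∎
  ⟦⟧≈ m (suc n) = sym (+-cong (×ᵤ≈× m 1#) (-‿cong (×ᵤ≈× (suc n) 1#)))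

  coefficients : RawRing 0ℓ 0ℓ
  coefficients = record
    { Carrier = ℕ × ℕ ; _≈_ = _≡_
    ; _+_ = λ (a , b) (c , d) → a ℕ.+ c , b ℕ.+ d
    ; _*_ = λ (a , b) (c , d) → a ℕ.* c ℕ.+ b ℕ.* d , a ℕ.* d ℕ.+ b ℕ.* c
    ; -_  = λ (a , b) → b , a
    ; 0#  = 0 , 0 ; 1# = 1 , 0 }

  interchange : ∀ a b c d → (a + c) - (b + d) ≈ (a - b) + (c - d)
  interchange a b c d = begin
    (a + c) - (b + d)       ≈⟨ +-congˡ (⁻¹-∙-comm b d) ⟨
    (a + c) + (- b + - d)   ≈⟨ SR.solve 4 (λ a b c d → (a SR.:+ c) SR.:+ (b SR.:+ d) SR.:= (a SR.:+ b) SR.:+ (c SR.:+ d)) refl a (- b) c (- d) ⟩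
    (a - b) + (c - d)       ∎

  mult : ∀ a b c d → (a * c + b * d) - (a * d + b * c) ≈ (a - b) * (c - d)
  mult a b c d = begin
    (a * c + b * d) - (a * d + b * c)
      ≈⟨ +-congˡ (⁻¹-∙-comm _ _) ⟨
    (a * c + b * d) + (- (a * d) + - (b * c))
      ≈⟨ +-cong (+-congˡ b*d≈) (+-cong (-‿distribʳ-* a d) (-‿distribˡ-* b c)) ⟩
    (a * c + - b * - d) + (a * - d + - b * c)
      ≈⟨ SR.solve 4 (λ a b c d → (a SR.:* c SR.:+ b SR.:* d) SR.:+ (a SR.:* d SR.:+ b SR.:* c) SR.:= (a SR.:+ b) SR.:* (c SR.:+ d)) refl a (- b) c (- d) ⟩
    (a - b) * (c - d) ∎
    where
    b*d≈ : b * d ≈ - b * - d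
    b*d≈ = begin
      b * d         ≈⟨ ⁻¹-involutive _ ⟨
      - (- (b * d)) ≈⟨ -‿cong (-‿distribʳ-* b d) ⟩
      - (b * - d)   ≈⟨ -‿distribˡ-* b (- d) ⟩
      - b * - d     ∎

  morphism : coefficients -Raw-AlmostCommutative⟶ fromCommutativeRing R
  morphism = record
    { ⟦_⟧ = ⟦_⟧
    ; +-homo = λ (a , b) (c , d) → begin
        ⟦ a ℕ.+ c , b ℕ.+ d ⟧                          ≈⟨ ⟦⟧≈ (a ℕ.+ c) (b ℕ.+ d) ⟩
        (a ℕ.+ c) · 1# - (b ℕ.+ d) · 1#                ≈⟨ +-cong (×-homo-+ 1# a c) (-‿cong (×-homo-+ 1# b d)) ⟩
        (a · 1# + c · 1#) - (b · 1# + d · 1#)          ≈⟨ interchange _ _ _ _ ⟩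
        (a · 1# - b · 1#) + (c · 1# - d · 1#)          ≈⟨ +-cong (⟦⟧≈ a b) (⟦⟧≈ c d) ⟨
        ⟦ a , b ⟧ + ⟦ c , d ⟧                          ∎
    ; *-homo = λ (a , b) (c , d) → begin
        ⟦ a ℕ.* c ℕ.+ b ℕ.* d , a ℕ.* d ℕ.+ b ℕ.* c ⟧ ≈⟨ ⟦⟧≈ (a ℕ.* c ℕ.+ b ℕ.* d) (a ℕ.* d ℕ.+ b ℕ.* c) ⟩
        (a ℕ.* c ℕ.+ b ℕ.* d) · 1# - (a ℕ.* d ℕ.+ b ℕ.* c) · 1#
          ≈⟨ +-cong (product a b c d) (-‿cong (product a b d c)) ⟩
        (a · 1# * (c · 1#) + b · 1# * (d · 1#)) - (a · 1# * (d · 1#) + b · 1# * (c · 1#)) ≈⟨ mult _ _ _ _ ⟩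
        (a · 1# - b · 1#) * (c · 1# - d · 1#)          ≈⟨ *-cong (⟦⟧≈ a b) (⟦⟧≈ c d) ⟨
        ⟦ a , b ⟧ * ⟦ c , d ⟧                          ∎
    ; -‿homo = λ (a , b) → begin
        ⟦ b , a ⟧                 ≈⟨ ⟦⟧≈ b a ⟩
        b · 1# - a · 1#           ≈⟨ +-comm _ _ ⟩
        - (a · 1#) + b · 1#       ≈⟨ +-congˡ (⁻¹-involutive _) ⟨
        - (a · 1#) + - - (b · 1#) ≈⟨ ⁻¹-∙-comm _ _ ⟩
        - (a · 1# - b · 1#)       ≈⟨ -‿cong (⟦⟧≈ a b) ⟨
        - ⟦ a , b ⟧               ∎
    ; 0-homo = refl
    ; 1-homo = refl
    }
    where
    product : ∀ a b c d → (a ℕ.* c ℕ.+ b ℕ.* d) · 1# ≈ a · 1# * (c · 1#) + b · 1# * (d · 1#)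
    product a b c d = trans (×-homo-+ 1# (a ℕ.* c) _) (+-cong (×1-homo-* a c) (×1-homo-* b d))

  _coeff≟_ : ∀ x y → Maybe (⟦ x ⟧ ≈ ⟦ y ⟧)
  (a , b) coeff≟ (c , d) with a ℕ.+ d ℕ.≟ c ℕ.+ b
  ... | no _  = nothing
  ... | yes e = just (begin
    ⟦ a , b ⟧                                 ≈⟨ ⟦⟧≈ a b ⟩
    a · 1# - b · 1#                           ≈⟨ cancel (a · 1#) (b · 1#) (d · 1#) ⟨
    (a · 1# + d · 1#) - (b · 1# + d · 1#)     ≈⟨ +-congʳ (×-homo-+ 1# a d) ⟨
    (a ℕ.+ d) · 1# - (b · 1# + d · 1#)        ≡⟨ ≡.cong (λ n → n · 1# - (b · 1# + d · 1#)) e ⟩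
    (c ℕ.+ b) · 1# - (b · 1# + d · 1#)        ≈⟨ +-cong (×-homo-+ 1# c b) (-‿cong (+-comm _ _)) ⟩
    (c · 1# + b · 1#) - (d · 1# + b · 1#)     ≈⟨ cancel (c · 1#) (d · 1#) (b · 1#) ⟩
    c · 1# - d · 1#                           ≈⟨ ⟦⟧≈ c d ⟨
    ⟦ c , d ⟧ ∎)
    where
    cancel : ∀ x y z → (x + z) - (y + z) ≈ x - y
    cancel x y z = trans (interchange x y z z) (trans (+-congˡ (-‿inverseʳ z)) (+-identityʳ _))

  open Solver coefficients (fromCommutativeRing R) morphism _coeff≟_ public
    using (solve; _:=_; _:+_; _:*_; _:-_; :-_; con; Polynomial)

  :0 :1 :2 : ∀ {n} → Polynomial n
  :0 = con (0 , 0)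
  :1 = con (1 , 0)
  :2 = con (2 , 0)

-- The form in block coordinates and its dual basis

module Form {c ℓ} (R : CommutativeRing c ℓ) (ν δ : ℕ) (z : CommutativeRing.Carrier R) (useZ : Bool) where
  open CommutativeRing R hiding (zero)
  open Orthogonal R ν δ z useZ
  open RingSolver R
  open import Algebra.Properties.Semiring.Sum semiring using (sum; sum-cong-≋; sum-replicate-zero; *-distribˡ-sum; ∑-distrib-+)
  open import Data.Vec.Functional.Relation.Binary.Equality.Setoid setoid using (_≋_)
  open import Relation.Binary.Reasoning.Setoid setoid

  sum-split : ∀ m {n} (g : Fin (m ℕ.+ n) → Carrier) → sum g ≈ sum (g ∘ (_↑ˡ n)) + sum (g ∘ (m ↑ʳ_))
  sum-split zero    g = sym (+-identityˡ _)
  sum-split (suc m) g = trans (+-congˡ (sum-split m (g ∘ suc))) (sym (+-assoc _ _ _))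

  sum-zero : ∀ {n} (g : Fin n → Carrier) → (∀ i → g i ≈ 0#) → sum g ≈ 0#
  sum-zero {n} g e = trans (sum-cong-≋ e) (sum-replicate-zero n)

  sum-single : ∀ {n} (g : Fin n → Carrier) k → (∀ i → i ≢ k → g i ≈ 0#) → sum g ≈ g k
  sum-single g zero    off = trans (+-congˡ (sum-zero (g ∘ suc) (λ i → off (suc i) λ ()))) (+-identityʳ _)
  sum-single g (suc k) off = trans (+-cong (off zero λ ()) (sum-single (g ∘ suc) k (λ i i≢k → off (suc i) λ { ≡.refl → i≢k ≡.refl }))) (+-identityˡ _)

  infixl 7 _∙_
  _∙_ : ∀ {n} → (Fin n → Carrier) → (Fin n → Carrier) → Carrier
  a ∙ b = sum (λ i → a i * b i)

  ∙-cong : ∀ {n} {a a′ b b′ : Fin n → Carrier} → a ≋ a′ → b ≋ b′ → a ∙ b ≈ a′ ∙ b′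
  ∙-cong e f = sum-cong-≋ (λ i → *-cong (e i) (f i))

  ∙-comm : ∀ {n} (a b : Fin n → Carrier) → a ∙ b ≈ b ∙ a
  ∙-comm a b = sum-cong-≋ (λ i → *-comm (a i) (b i))

  ∙-·ʳ : ∀ {n} (a : Fin n → Carrier) t b → a ∙ (λ i → t * b i) ≈ t * (a ∙ b)
  ∙-·ʳ a t b = begin
    sum (λ i → a i * (t * b i)) ≈⟨ sum-cong-≋ (λ i → solve 3 (λ a t b → a :* (t :* b) := t :* (a :* b)) refl (a i) t (b i)) ⟩
    sum (λ i → t * (a i * b i)) ≈⟨ *-distribˡ-sum t (λ i → a i * b i) ⟨
    t * (a ∙ b)                 ∎

  ∙-+ʳ : ∀ {n} (a b : Fin n → Carrier) t d → a ∙ (λ i → b i + t * d i) ≈ a ∙ b + t * (a ∙ d)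
  ∙-+ʳ a b t d = begin
    sum (λ i → a i * (b i + t * d i))       ≈⟨ sum-cong-≋ (λ i → distribˡ (a i) (b i) _) ⟩
    sum (λ i → a i * b i + a i * (t * d i)) ≈⟨ ∑-distrib-+ (λ i → a i * b i) (λ i → a i * (t * d i)) ⟩
    a ∙ b + a ∙ (λ i → t * d i)             ≈⟨ +-congˡ (∙-·ʳ a t d) ⟩
    a ∙ b + t * (a ∙ d)                     ∎

  -- `2 * ν` unfolds to `ν + (ν + 0)`; the summand `ν + 0` in these embeddings and the empty vector
  -- in `append` mirror that final `0`.
  Lᵢ Mᵢ : Fin ν → Fin N
  Lᵢ i = (i ↑ˡ (ν ℕ.+ 0)) ↑ˡ δ
  Mᵢ i = (ν ↑ʳ (i ↑ˡ 0)) ↑ˡ δ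

  Dᵢ : Fin δ → Fin N
  Dᵢ k = (2 ℕ.* ν) ↑ʳ k

  toℕ-L : ∀ i → toℕ (Lᵢ i) ≡ toℕ i
  toℕ-L i = ≡.trans (toℕ-↑ˡ _ δ) (toℕ-↑ˡ i _)

  toℕ-M : ∀ i → toℕ (Mᵢ i) ≡ ν ℕ.+ toℕ i
  toℕ-M i = ≡.trans (toℕ-↑ˡ _ δ) (≡.trans (toℕ-↑ʳ ν _) (≡.cong (ν ℕ.+_) (toℕ-↑ˡ i 0)))

  toℕ-D : ∀ k → toℕ (Dᵢ k) ≡ 2 ℕ.* ν ℕ.+ toℕ k
  toℕ-D k = toℕ-↑ʳ (2 ℕ.* ν) k

  append : (Fin ν → Carrier) → (Fin ν → Carrier) → (Fin δ → Carrier) → Vector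
  append a b d = (a Vector.++ (b Vector.++ Vector.[])) Vector.++ d

  append-L : ∀ a b d i → append a b d (Lᵢ i) ≈ a i
  append-L a b d i = reflexive (≡.trans (lookup-++ˡ (a Vector.++ (b Vector.++ Vector.[])) d (i ↑ˡ (ν ℕ.+ 0))) (lookup-++ˡ a (b Vector.++ Vector.[]) i))

  append-M : ∀ a b d i → append a b d (Mᵢ i) ≈ b i
  append-M a b d i = reflexive (≡.trans (lookup-++ˡ (a Vector.++ (b Vector.++ Vector.[])) d (ν ↑ʳ (i ↑ˡ 0)))
    (≡.trans (lookup-++ʳ a (b Vector.++ Vector.[]) (i ↑ˡ 0)) (lookup-++ˡ b Vector.[] i)))

  append-D : ∀ a b d k → append a b d (Dᵢ k) ≈ d k
  append-D a b d k = reflexive (lookup-++ʳ (a Vector.++ (b Vector.++ Vector.[])) d k)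

  data Block : Fin N → Set where
    inL : ∀ i → Block (Lᵢ i)
    inM : ∀ i → Block (Mᵢ i)
    inD : ∀ k → Block (Dᵢ k)

  block : ∀ i → Block i
  block i with splitAt (2 ℕ.* ν) i in e
  ... | inj₂ k = ≡.subst Block (splitAt⁻¹-↑ʳ e) (inD k)
  ... | inj₁ j with splitAt ν j in f
  ...   | inj₁ l = ≡.subst Block (≡.trans (≡.cong (_↑ˡ δ) (splitAt⁻¹-↑ˡ f)) (splitAt⁻¹-↑ˡ e)) (inL l)
  ...   | inj₂ l with splitAt ν l in g
  ...     | inj₁ k = ≡.subst Block (≡.trans (≡.cong (_↑ˡ δ)
                       (≡.trans (≡.cong (ν ↑ʳ_) (splitAt⁻¹-↑ˡ g)) (splitAt⁻¹-↑ʳ f))) (splitAt⁻¹-↑ˡ e)) (inM k)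

  ≋-blocks : ∀ {v w : Vector} → (v ∘ Lᵢ) ≋ (w ∘ Lᵢ) → (v ∘ Mᵢ) ≋ (w ∘ Mᵢ) → (v ∘ Dᵢ) ≋ (w ∘ Dᵢ) → v ≋ w
  ≋-blocks {v} {w} e f g i = at (block i)
    where
    at : ∀ {i} → Block i → v i ≈ w i
    at (inL j) = e j
    at (inM j) = f j
    at (inD k) = g k

  sum-blocks : ∀ (g : Fin N → Carrier) → sum g ≈ sum (g ∘ Lᵢ) + sum (g ∘ Mᵢ) + sum (g ∘ Dᵢ)
  sum-blocks g = begin
    sum g ≈⟨ sum-split (2 ℕ.* ν) g ⟩
    sum (g ∘ (_↑ˡ δ)) + sum (g ∘ Dᵢ) ≈⟨ +-congʳ (sum-split ν (g ∘ (_↑ˡ δ))) ⟩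
    sum (g ∘ Lᵢ) + sum (g ∘ (_↑ˡ δ) ∘ (ν ↑ʳ_)) + sum (g ∘ Dᵢ)
      ≈⟨ +-congʳ (+-congˡ (trans (sum-split ν (g ∘ (_↑ˡ δ) ∘ (ν ↑ʳ_))) (+-identityʳ _))) ⟩
    sum (g ∘ Lᵢ) + sum (g ∘ Mᵢ) + sum (g ∘ Dᵢ) ∎

  Inside : ℕ → ℕ → Set
  Inside a b = a < 2 ℕ.* ν × b < 2 ℕ.* ν

  private
    T-inside : ∀ a b → T ((a <ᵇ 2 ℕ.* ν) ∧ (b <ᵇ 2 ℕ.* ν)) → Inside a b
    T-inside a b t = let l , r = Equivalence.to T-∧ t in ℕₚ.<ᵇ⇒< a _ l , ℕₚ.<ᵇ⇒< b _ r

    inside-T : ∀ {a b} → Inside a b → T ((a <ᵇ 2 ℕ.* ν) ∧ (b <ᵇ 2 ℕ.* ν))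
    inside-T (l , r) = Equivalence.from T-∧ (ℕₚ.<⇒<ᵇ l , ℕₚ.<⇒<ᵇ r)

    if-T : ∀ {a} {A : Set a} {b} {x y : A} → T b → (if b then x else y) ≡ x
    if-T {b = true} _ = ≡.refl

    if-¬T : ∀ {a} {A : Set a} {b} {x y : A} → ¬ T b → (if b then x else y) ≡ y
    if-¬T {b = false} _ = ≡.refl
    if-¬T {b = true}  f = ⊥-elim (f _)

  S-zero : ∀ i j → (Inside (toℕ i) (toℕ j) → toℕ i ℕ.+ ν ≢ toℕ j × toℕ j ℕ.+ ν ≢ toℕ i) →
    (¬ Inside (toℕ i) (toℕ j) → toℕ i ≢ toℕ j) → S i j ≡ 0#
  S-zero i j inside outside with T? ((toℕ i <ᵇ 2 ℕ.* ν) ∧ (toℕ j <ᵇ 2 ℕ.* ν))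
  ... | yes t = ≡.trans (if-T t) (if-¬T λ t′ → let ≢₁ , ≢₂ = inside (T-inside _ _ t) in
                  [ ≢₁ ∘ ℕₚ.≡ᵇ⇒≡ _ _ , ≢₂ ∘ ℕₚ.≡ᵇ⇒≡ _ _ ]′ (Equivalence.to T-∨ t′))
  ... | no ¬t = ≡.trans (if-¬T ¬t) (if-¬T (outside (¬t ∘ inside-T) ∘ ℕₚ.≡ᵇ⇒≡ _ _))

  S-one : ∀ i j → Inside (toℕ i) (toℕ j) → toℕ i ℕ.+ ν ≡ toℕ j ⊎ toℕ j ℕ.+ ν ≡ toℕ i → S i j ≡ 1#
  S-one i j inside e = ≡.trans (if-T (inside-T inside)) (if-T (Equivalence.from T-∨ (map-⊎ (ℕₚ.≡⇒≡ᵇ _ _) (ℕₚ.≡⇒≡ᵇ _ _) e)))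

  S-diagonal : ∀ i → ¬ Inside (toℕ i) (toℕ i) → S i i ≡ Δentry δ (toℕ i ℕ.∸ 2 ℕ.* ν)
  S-diagonal i outside = ≡.trans (if-¬T (outside ∘ T-inside _ _)) (if-T (ℕₚ.≡⇒≡ᵇ (toℕ i) _ ≡.refl))

  toℕ-L< : ∀ i → toℕ (Lᵢ i) < ν
  toℕ-L< i = ≡.subst (_< ν) (≡.sym (toℕ-L i)) (toℕ<n i)

  2ν≡ : 2 ℕ.* ν ≡ ν ℕ.+ ν
  2ν≡ = ≡.cong (ν ℕ.+_) (ℕₚ.+-identityʳ ν)

  ν≤2ν : ν ≤ 2 ℕ.* ν
  ν≤2ν = ℕₚ.m≤m+n ν _

  toℕ-M< : ∀ i → toℕ (Mᵢ i) < 2 ℕ.* ν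
  toℕ-M< i = ≡.subst₂ _<_ (≡.sym (toℕ-M i)) (≡.sym 2ν≡) (ℕₚ.+-monoʳ-< ν (toℕ<n i))

  toℕ-D≥ : ∀ k → ¬ (toℕ (Dᵢ k) < 2 ℕ.* ν)
  toℕ-D≥ k = ℕₚ.≤⇒≯ (≡.subst (2 ℕ.* ν ≤_) (≡.sym (toℕ-D k)) (ℕₚ.m≤m+n _ _))

  toℕ-L+ν : ∀ i → toℕ (Lᵢ i) ℕ.+ ν ≡ toℕ (Mᵢ i)
  toℕ-L+ν i = ≡.trans (≡.cong (ℕ._+ ν) (toℕ-L i)) (≡.trans (ℕₚ.+-comm (toℕ i) ν) (≡.sym (toℕ-M i)))

  Δ : Fin δ → Carrier
  Δ k = Δentry δ (toℕ k)

  S-LM : ∀ i → S (Lᵢ i) (Mᵢ i) ≡ 1#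
  S-LM i = S-one _ _ (ℕₚ.<-≤-trans (toℕ-L< i) ν≤2ν , toℕ-M< i) (inj₁ (toℕ-L+ν i))

  S-ML : ∀ i → S (Mᵢ i) (Lᵢ i) ≡ 1#
  S-ML i = S-one _ _ (toℕ-M< i , ℕₚ.<-≤-trans (toℕ-L< i) ν≤2ν) (inj₂ (toℕ-L+ν i))

  S-DD : ∀ k → S (Dᵢ k) (Dᵢ k) ≡ Δ k
  S-DD k = ≡.trans (S-diagonal (Dᵢ k) (toℕ-D≥ k ∘ proj₁))
    (≡.cong (Δentry δ) (≡.trans (≡.cong (ℕ._∸ 2 ℕ.* ν) (toℕ-D k)) (ℕₚ.m+n∸m≡n (2 ℕ.* ν) (toℕ k))))

  S-L : ∀ i j → j ≢ Mᵢ i → S (Lᵢ i) j ≡ 0#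
  S-L i j ≢ = S-zero (Lᵢ i) j
    (λ _ → (λ e → ≢ (toℕ-injective (≡.trans (≡.sym e) (toℕ-L+ν i)))) ,
           (λ e → ℕₚ.<⇒≱ (toℕ-L< i) (≡.subst (ν ≤_) e (ℕₚ.m≤n+m ν (toℕ j)))))
    (λ outside e → outside (let l = ℕₚ.<-≤-trans (toℕ-L< i) ν≤2ν in l , ≡.subst (_< 2 ℕ.* ν) e l))

  S-M : ∀ i j → j ≢ Lᵢ i → S (Mᵢ i) j ≡ 0#
  S-M i j ≢ = S-zero (Mᵢ i) j
    (λ (_ , j<) → (λ e → ℕₚ.<⇒≱ j< (≡.subst₂ _≤_ (≡.sym 2ν≡) e
                     (ℕₚ.+-monoˡ-≤ ν (≡.subst (ν ≤_) (≡.sym (toℕ-M i)) (ℕₚ.m≤m+n ν _))))) ,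
           (λ e → ≢ (toℕ-injective (ℕₚ.+-cancelʳ-≡ ν _ _ (≡.trans e (≡.sym (toℕ-L+ν i)))))))
    (λ outside e → outside (toℕ-M< i , ≡.subst (_< 2 ℕ.* ν) e (toℕ-M< i)))

  S-D : ∀ k j → j ≢ Dᵢ k → S (Dᵢ k) j ≡ 0#
  S-D k j ≢ = S-zero (Dᵢ k) j (λ (l , _) → ⊥-elim (toℕ-D≥ k l)) (λ _ e → ≢ (toℕ-injective (≡.sym e)))

  -- A row of `S` has at most one non-zero entry, in column `k`, so the inner sum of `form`
  -- collapses to a single term. This turns the Boolean description of `S` into the formula
  -- `form-blocks`.
  row : ∀ i k w → S i k ≡ w → (∀ j → j ≢ k → S i j ≡ 0#) → ∀ a (β : Vector) →
    sum (λ j → a * S i j * β j) ≈ a * (w * β k)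
  row i k w on off a β = begin
    sum (λ j → a * S i j * β j) ≈⟨ sum-single _ k (λ j j≢k → begin
        a * S i j * β j ≡⟨ ≡.cong (λ x → a * x * β j) (off j j≢k) ⟩
        a * 0# * β j    ≈⟨ solve 2 (λ a b → a :* :0 :* b := :0) refl a (β j) ⟩
        0#              ∎) ⟩
    a * S i k * β k ≡⟨ ≡.cong (λ x → a * x * β k) on ⟩
    a * w * β k     ≈⟨ *-assoc a w (β k) ⟩
    a * (w * β k)   ∎

  row-L : ∀ i a β → sum (λ j → a * S (Lᵢ i) j * β j) ≈ a * β (Mᵢ i)
  row-L i a β = trans (row (Lᵢ i) (Mᵢ i) 1# (S-LM i) (S-L i) a β) (*-congˡ (*-identityˡ _))

  row-M : ∀ i a β → sum (λ j → a * S (Mᵢ i) j * β j) ≈ a * β (Lᵢ i)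
  row-M i a β = trans (row (Mᵢ i) (Lᵢ i) 1# (S-ML i) (S-M i) a β) (*-congˡ (*-identityˡ _))

  row-D : ∀ k a β → sum (λ j → a * S (Dᵢ k) j * β j) ≈ a * (Δ k * β (Dᵢ k))
  row-D k = row (Dᵢ k) (Dᵢ k) (Δ k) (S-DD k) (S-D k)

  form-blocks : ∀ α β → form α β ≈
    (α ∘ Lᵢ) ∙ (β ∘ Mᵢ) + (α ∘ Mᵢ) ∙ (β ∘ Lᵢ) + (α ∘ Dᵢ) ∙ (λ k → Δ k * β (Dᵢ k))
  form-blocks α β = trans (sum-blocks (λ i → sum (λ j → α i * S i j * β j)))
    (+-cong (+-cong (sum-cong-≋ (λ i → row-L i _ β)) (sum-cong-≋ (λ i → row-M i _ β)))
            (sum-cong-≋ (λ k → row-D k _ β)))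

  Δ∙-comm : ∀ a b → a ∙ (λ k → Δ k * b k) ≈ b ∙ (λ k → Δ k * a k)
  Δ∙-comm a b = sum-cong-≋ (λ k → solve 3 (λ a d b → a :* (d :* b) := b :* (d :* a)) refl (a k) (Δ k) (b k))

  form-sym : ∀ α β → form α β ≈ form β α
  form-sym α β = begin
    form α β ≈⟨ form-blocks α β ⟩
    (α ∘ Lᵢ) ∙ (β ∘ Mᵢ) + (α ∘ Mᵢ) ∙ (β ∘ Lᵢ) + (α ∘ Dᵢ) ∙ (λ k → Δ k * β (Dᵢ k))
      ≈⟨ +-cong (trans (+-comm _ _) (+-cong (∙-comm (α ∘ Mᵢ) (β ∘ Lᵢ)) (∙-comm (α ∘ Lᵢ) (β ∘ Mᵢ)))) (Δ∙-comm (α ∘ Dᵢ) (β ∘ Dᵢ)) ⟩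
    (β ∘ Lᵢ) ∙ (α ∘ Mᵢ) + (β ∘ Mᵢ) ∙ (α ∘ Lᵢ) + (β ∘ Dᵢ) ∙ (λ k → Δ k * α (Dᵢ k))
      ≈⟨ form-blocks β α ⟨
    form β α ∎

  form-congʳ : ∀ {α β γ : Vector} → β ≋ γ → form α β ≈ form α γ
  form-congʳ {α} e = sum-cong-≋ (λ i → ∙-cong {a = λ j → α i * S i j} (λ _ → refl) e)

  form-·ʳ : ∀ α t β → form α (λ i → t * β i) ≈ t * form α β
  form-·ʳ α t β = trans (sum-cong-≋ (λ i → ∙-·ʳ (λ j → α i * S i j) t β)) (sym (*-distribˡ-sum t (λ i → sum (λ j → α i * S i j * β j))))

  form-+ʳ : ∀ α β t γ → form α (λ i → β i + t * γ i) ≈ form α β + t * form α γ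
  form-+ʳ α β t γ = begin
    form α (λ i → β i + t * γ i)
      ≈⟨ sum-cong-≋ (λ i → ∙-+ʳ (λ j → α i * S i j) β t γ) ⟩
    sum (λ i → (λ j → α i * S i j) ∙ β + t * ((λ j → α i * S i j) ∙ γ))
      ≈⟨ ∑-distrib-+ (λ i → (λ j → α i * S i j) ∙ β) _ ⟩
    form α β + sum (λ i → t * ((λ j → α i * S i j) ∙ γ))
      ≈⟨ +-congˡ (*-distribˡ-sum t (λ i → (λ j → α i * S i j) ∙ γ)) ⟨
    form α β + t * form α γ ∎

  basis : Fin N → Vector
  basis k i with i ≟ᶠ k
  ... | yes _ = 1#
  ... | no  _ = 0#

  basis-off : ∀ k i → i ≢ k → basis k i ≈ 0#
  basis-off k i i≢k with i ≟ᶠ k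
  ... | yes e = ⊥-elim (i≢k e)
  ... | no  _ = refl

  basis-on : ∀ k → basis k k ≈ 1#
  basis-on k with k ≟ᶠ k
  ... | yes _ = refl
  ... | no ≢  = ⊥-elim (≢ ≡.refl)

  form-basis : ∀ v k → form v (basis k) ≈ sum (λ j → 1# * S k j * v j)
  form-basis v k = begin
    form v (basis k) ≈⟨ form-sym v (basis k) ⟩
    form (basis k) v ≈⟨ sum-single (λ i → sum (λ j → basis k i * S i j * v j)) k (λ i i≢k → sum-zero _ (λ j → begin
      basis k i * S i j * v j ≈⟨ *-congʳ (*-congʳ (basis-off k i i≢k)) ⟩
      0# * S i j * v j        ≈⟨ solve 2 (λ a b → :0 :* a :* b := :0) refl (S i j) (v j) ⟩
      0#                      ∎)) ⟩
    sum (λ j → basis k k * S k j * v j) ≈⟨ ∙-cong {b = v} (λ j → *-congʳ (basis-on k)) (λ _ → refl) ⟩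
    sum (λ j → 1# * S k j * v j) ∎

  -- Non-degeneracy made explicit: `dualAt` lists the columns of the inverse of `S`, which exchanges
  -- the two hyperbolic blocks and inverts `Δ`. Vectors with prescribed pairings can then be written
  -- down.
  module Dual (Δ⁻¹ : Fin δ → Carrier) (Δ-inverse : ∀ k → Δ k * Δ⁻¹ k ≈ 1#) where

    dualAt : ∀ {i} → Block i → Vector
    dualAt (inL i) = basis (Mᵢ i)
    dualAt (inM i) = basis (Lᵢ i)
    dualAt (inD k) = λ j → Δ⁻¹ k * basis (Dᵢ k) j

    form-dualAt : ∀ v {i} (b : Block i) → form v (dualAt b) ≈ v i
    form-dualAt v (inL i) = trans (form-basis v _) (trans (row-M i 1# v) (*-identityˡ _))
    form-dualAt v (inM i) = trans (form-basis v _) (trans (row-L i 1# v) (*-identityˡ _))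
    form-dualAt v (inD k) = begin
      form v (λ j → Δ⁻¹ k * basis (Dᵢ k) j)  ≈⟨ form-·ʳ v (Δ⁻¹ k) (basis (Dᵢ k)) ⟩
      Δ⁻¹ k * form v (basis (Dᵢ k))          ≈⟨ *-congˡ (trans (form-basis v _) (row-D k 1# v)) ⟩
      Δ⁻¹ k * (1# * (Δ k * v (Dᵢ k)))
        ≈⟨ solve 3 (λ a d x → a :* (:1 :* (d :* x)) := d :* a :* x) refl (Δ⁻¹ k) (Δ k) (v (Dᵢ k)) ⟩
      Δ k * Δ⁻¹ k * v (Dᵢ k)                 ≈⟨ *-congʳ (Δ-inverse k) ⟩
      1# * v (Dᵢ k)                          ≈⟨ *-identityˡ _ ⟩
      v (Dᵢ k)                               ∎

-- Point counts over the residue field and the stated parameters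

module Arithmetic where
  open import Data.Nat
  open import Data.Nat.DivMod using (m*n/n≡m; /-congˡ)
  open import Data.Nat.Properties
  open import Relation.Binary.PropositionalEquality
  open ≡-Reasoning

  -- The counts of the quadratic form of rank 2 n + δ over the residue field with q = 1 + u elements:
  -- t n is the number of its zeros and y n the number of its projective zeros.
  module ResidueCounts (u δ : ℕ) where
    q : ℕ
    q = suc u

    -- In coordinates `(a , b , x)` with form `2ab + Q x`, each of the `u` values `a ≠ 0` leaves `x`
    -- free and determines `b`, while `a = 0` leaves `b` free and requires `Q x = 0`. For `y`, the
    -- first non-zero entry among `a` and `b` is scaled to 1. The initial values say that the part
    -- of rank `δ` is anisotropic.
    t : ℕ → ℕ
    t zero    = 1
    t (suc n) = u * q ^ (2 * n + δ) + q * t n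

    y : ℕ → ℕ
    y zero    = 0
    y (suc n) = q ^ (2 * n + δ) + t n + y n

    q^2n+δ : ∀ n → q ^ (2 * n + δ) ≡ q ^ n * q ^ n * q ^ δ
    q^2n+δ n = begin
      q ^ (2 * n + δ)         ≡⟨ ^-distribˡ-+-* q (2 * n) δ ⟩
      q ^ (2 * n) * q ^ δ     ≡⟨ cong (_* q ^ δ) (trans (^-distribˡ-+-* q n (n + 0)) (cong (λ k → q ^ n * q ^ k) (+-identityʳ n))) ⟩
      q ^ n * q ^ n * q ^ δ   ∎

    -- Without subtraction this is `t n = q^n + q^(2n+δ-1) - q^(n+δ-1)`; the factor `q` clears the
    -- exponent `-1` that occurs at `n = δ = 0`.
    t-closed : ∀ n → q * t n + q ^ n * q ^ δ ≡ q * q ^ n + q ^ n * q ^ n * q ^ δ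
    t-closed zero    = identity u (q ^ δ)
      where
      identity : ∀ u D → (1 + u) * 1 + 1 * D ≡ (1 + u) * 1 + 1 * 1 * D
      identity = solve-∀
    t-closed (suc n) = begin
      q * (u * q ^ (2 * n + δ) + q * t n) + q * X * D
        ≡⟨ cong (λ e → q * (u * e + q * t n) + q * X * D) (q^2n+δ n) ⟩
      q * (u * (X * X * D) + q * t n) + q * X * D
        ≡⟨ left u X D (t n) ⟩
      q * u * (X * X * D) + q * (q * t n + X * D)
        ≡⟨ cong (λ e → q * u * (X * X * D) + q * e) (t-closed n) ⟩
      q * u * (X * X * D) + q * (q * X + X * X * D)
        ≡⟨ right u X D ⟩
      q * (q * X) + q * X * (q * X) * D ∎
      where
      X = q ^ n
      D = q ^ δ
      left : ∀ u X D τ → (1 + u) * (u * (X * X * D) + (1 + u) * τ) + (1 + u) * X * D ≡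
        (1 + u) * u * (X * X * D) + (1 + u) * ((1 + u) * τ + X * D)
      left = solve-∀
      right : ∀ u X D → (1 + u) * u * (X * X * D) + (1 + u) * ((1 + u) * X + X * X * D) ≡
        (1 + u) * ((1 + u) * X) + (1 + u) * X * ((1 + u) * X) * D
      right = solve-∀

    -- This encodes `y (n+1) = (q^(n+1) - 1)(q^(n+δ) + 1) / (q - 1)`, the number of points of a
    -- projective quadric, without subtraction or division.
    y-closed : ∀ n → u * y (suc n) + (q ^ n * q ^ δ + 1) ≡ q * q ^ n * (q ^ n * q ^ δ + 1)
    y-closed zero    = identity u (q ^ δ)
      where
      identity : ∀ u D → u * (D + 1 + 0) + (1 * D + 1) ≡ (1 + u) * 1 * (1 * D + 1)
      identity = solve-∀
    y-closed (suc n) = trans (cong (λ e → u * (e + τ + η) + (q * X * D + 1)) (q^2n+δ (suc n)))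
      -- Scaling by `q` and adding `q * (q * X * D)` makes the left sides of `t-closed` and of the
      -- induction hypothesis appear together.
      (*-cancelˡ-≡ _ _ q (+-cancelʳ-≡ (q * (q * X * D)) _ _ (begin
        q * (u * (q * X * (q * X) * D + τ + η) + (q * X * D + 1)) + q * (q * X * D)
          ≡⟨ left u X D τ η ⟩
        q * u * (q * X * (q * X) * D) + u * (q * τ + q * X * D) + q * (u * η + (X * D + 1)) + q * (q * X * D)
          ≡⟨ cong₂ (λ a b → q * u * (q * X * (q * X) * D) + u * a + q * b + q * (q * X * D)) (t-closed (suc n)) (y-closed n) ⟩
        q * u * (q * X * (q * X) * D) + u * (q * (q * X) + q * X * (q * X) * D) + q * (q * X * (X * D + 1)) + q * (q * X * D)
          ≡⟨ right u X D ⟩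
        q * (q * (q * X) * (q * X * D + 1)) + q * (q * X * D) ∎)))
      where
      X = q ^ n
      D = q ^ δ
      τ = t (suc n)
      η = y (suc n)
      left : ∀ u X D τ η →
        (1 + u) * (u * ((1 + u) * X * ((1 + u) * X) * D + τ + η) + ((1 + u) * X * D + 1)) + (1 + u) * ((1 + u) * X * D) ≡
        (1 + u) * u * ((1 + u) * X * ((1 + u) * X) * D) + u * ((1 + u) * τ + (1 + u) * X * D)
          + (1 + u) * (u * η + (X * D + 1)) + (1 + u) * ((1 + u) * X * D)
      left = solve-∀
      right : ∀ u X D →
        (1 + u) * u * ((1 + u) * X * ((1 + u) * X) * D) + u * ((1 + u) * ((1 + u) * X) + (1 + u) * X * ((1 + u) * X) * D)
          + (1 + u) * ((1 + u) * X * (X * D + 1)) + (1 + u) * ((1 + u) * X * D) ≡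
        (1 + u) * ((1 + u) * ((1 + u) * X) * ((1 + u) * X * D + 1)) + (1 + u) * ((1 + u) * X * D)
      right = solve-∀

  double-suc : ∀ n → 2 * suc n ≡ suc (suc (2 * n))
  double-suc n = cong suc (+-suc n (n + 0))

  ^-distribʳ-* : ∀ n a b → (a * b) ^ n ≡ a ^ n * b ^ n
  ^-distribʳ-* zero    a b = refl
  ^-distribʳ-* (suc n) a b = trans (cong (a * b *_) (^-distribʳ-* n a b)) ([m*n]*[o*p]≡[m*o]*[n*p] a b (a ^ n) (b ^ n))

  -- `r` is the size of the ring and `P` that of its maximal ideal. The recursions keep the
  -- unsimplified shape that `hyperbolic` produces, so that `refl` can supply them.
  module TowerCounts (u δ P r units : ℕ) (r≡ : r ≡ suc u * P) (units≡ : units ≡ u * P)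
    (size singular zeros : ℕ → ℕ)
    (size-zero : size 0 ≡ r ^ δ) (size-suc : ∀ n → size (suc n) ≡ r * (r * size n))
    (singular-zero : singular 0 ≡ P ^ δ)
    (singular-suc : ∀ n → singular (suc n) ≡ units * size n * P + P * (r * singular n))
    (zeros-zero : zeros 0 ≡ 0)
    (zeros-suc : ∀ n → zeros (suc n) ≡ units * size n * 1 + (units * singular n * 1 + P * P * zeros n)) where

    open ResidueCounts u δ

    size≡ : ∀ n → size n ≡ r ^ (2 * n + δ)
    size≡ zero    = size-zero
    size≡ (suc n) = begin
      size (suc n)                ≡⟨ size-suc n ⟩
      r * (r * size n)            ≡⟨ cong (λ e → r * (r * e)) (size≡ n) ⟩
      r ^ (2 + (2 * n) + δ)       ≡⟨ cong (λ e → r ^ (e + δ)) (double-suc n) ⟨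
      r ^ (2 * suc n + δ)         ∎

    r^ : ∀ e → r ^ e ≡ q ^ e * P ^ e
    r^ e = trans (cong (_^ e) r≡) (^-distribʳ-* e q P)

    P^ : ∀ n → P ^ (2 * suc n + δ) ≡ P * (P * P ^ (2 * n + δ))
    P^ n = cong (λ e → P ^ (e + δ)) (double-suc n)

    -- Whether `Q v` is a non-unit depends only on `v` modulo the maximal ideal, and a residue
    -- vector of rank `2n + δ` has `P^(2n+δ)` lifts.
    singular≡ : ∀ n → singular n ≡ P ^ (2 * n + δ) * t n
    singular≡ zero    = trans singular-zero (sym (*-identityʳ _))
    singular≡ (suc n) = begin
      singular (suc n) ≡⟨ singular-suc n ⟩
      units * size n * P + P * (r * singular n)
        ≡⟨ cong₂ (λ a b → a * size n * P + P * (b * singular n)) units≡ r≡ ⟩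
      u * P * size n * P + P * (q * P * singular n)
        ≡⟨ cong₂ (λ a b → u * P * a * P + P * (q * P * b)) (trans (size≡ n) (r^ e)) (singular≡ n) ⟩
      u * P * (q ^ e * P ^ e) * P + P * (q * P * (P ^ e * t n))
        ≡⟨ identity u P (q ^ e) (P ^ e) (t n) ⟩
      P * (P * P ^ e) * (u * q ^ e + q * t n)
        ≡⟨ cong (_* t (suc n)) (P^ n) ⟨
      P ^ (2 * suc n + δ) * t (suc n) ∎
      where
      e = 2 * n + δ
      identity : ∀ u P Qe Pe τ → u * P * (Qe * Pe) * P + P * ((1 + u) * P * (Pe * τ)) ≡ P * (P * Pe) * (u * Qe + (1 + u) * τ)
      identity = solve-∀

    -- Behind the recursion is smooth lifting: for rank `2n + 2 + δ` the quadric has dimension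
    -- `2n + δ`, so each residue point lifts to `P^(2n+δ)` classes, each with `units`
    -- representatives.
    zeros≡ : ∀ n → zeros (suc n) ≡ P ^ (2 * n + δ) * y (suc n) * units
    zeros≡ n = trans (zeros-suc n) (trans
      (cong₂ (λ a b → units * a * 1 + (units * b * 1 + P * P * zeros n)) (trans (size≡ n) (r^ (2 * n + δ))) (singular≡ n)) (step n))
      where
      step : ∀ n → let e = 2 * n + δ in
        units * (q ^ e * P ^ e) * 1 + (units * (P ^ e * t n) * 1 + P * P * zeros n) ≡ P ^ e * y (suc n) * units
      step zero = trans (cong (λ e → units * (q ^ δ * P ^ δ) * 1 + (units * (P ^ δ * 1) * 1 + P * P * e)) zeros-zero)
        (identity units (q ^ δ) (P ^ δ) P)
        where
        identity : ∀ U Qe Pe P → U * (Qe * Pe) * 1 + (U * (Pe * 1) * 1 + P * P * 0) ≡ Pe * (Qe + 1 + 0) * U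
        identity = solve-∀
      step (suc n) = begin
        units * (q ^ e * P ^ e) * 1 + (units * (P ^ e * t (suc n)) * 1 + P * P * zeros (suc n))
          ≡⟨ cong₂ (λ a b → units * (q ^ e * a) * 1 + (units * (a * t (suc n)) * 1 + P * P * b)) (P^ n) (zeros≡ n) ⟩
        units * (q ^ e * (P * (P * P ^ e′))) * 1 + (units * (P * (P * P ^ e′) * t (suc n)) * 1 + P * P * (P ^ e′ * y (suc n) * units))
          ≡⟨ identity units (q ^ e) P (P ^ e′) (t (suc n)) (y (suc n)) ⟩
        P * (P * P ^ e′) * (q ^ e + t (suc n) + y (suc n)) * units
          ≡⟨ cong (λ a → a * y (suc (suc n)) * units) (P^ n) ⟨
        P ^ e * y (suc (suc n)) * units ∎
        where
        e = 2 * suc n + δ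
        e′ = 2 * n + δ
        identity : ∀ U Qe P Pe τ η → U * (Qe * (P * (P * Pe))) * 1 + (U * (P * (P * Pe) * τ) * 1 + P * P * (Pe * η * U)) ≡
          P * (P * Pe) * (Qe + τ + η) * U
        identity = solve-∀

  m*n≡k+n⇒[m∸1]*n≡k : ∀ {m n k} → k + n ≡ m * n → (m ∸ 1) * n ≡ k
  m*n≡k+n⇒[m∸1]*n≡k {m} {n} {k} e = begin
    (m ∸ 1) * n     ≡⟨ *-distribʳ-∸ n m 1 ⟩
    m * n ∸ 1 * n   ≡⟨ cong₂ _∸_ (sym e) (*-identityˡ n) ⟩
    k + n ∸ n       ≡⟨ m+n∸n≡m k n ⟩
    k               ∎

  module Parameters (p m u s′ w : ℕ) (p^m≡ : p ^ m ≡ suc u) where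
    q s ν P r : ℕ
    q = suc u
    s = suc s′
    ν = suc (suc w)
    P = q ^ s′
    r = q ^ s

    p^m* : ∀ e → p ^ (m * e) ≡ q ^ e
    p^m* e = trans (sym (^-*-assoc p m e)) (cong (_^ e) p^m≡)

    p^m∸1 : p ^ m ∸ 1 ≡ u
    p^m∸1 = cong (_∸ 1) p^m≡

    exponent : ∀ δ → 2 * ν + δ ∸ 2 ≡ 2 * suc w + δ
    exponent δ = cong (λ e → e + δ ∸ 2) (double-suc (suc w))

    s*[1+e]∸1 : ∀ e → s * suc e ∸ 1 ≡ s′ + s * e
    s*[1+e]∸1 e = cong (_∸ 1) (*-suc s e)

    q^[s*e-1] : ∀ e → q ^ (s * suc e ∸ 1) ≡ P * r ^ e
    q^[s*e-1] e = begin
      q ^ (s * suc e ∸ 1)   ≡⟨ cong (q ^_) (s*[1+e]∸1 e) ⟩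
      q ^ (s′ + s * e)      ≡⟨ ^-distribˡ-+-* q s′ (s * e) ⟩
      P * q ^ (s * e)       ≡⟨ cong (P *_) (^-*-assoc q s e) ⟨
      P * r ^ e             ∎

    kParam≡ : ∀ δ → kParam p s m ν δ ≡ r ^ (2 * suc w + δ)
    kParam≡ δ = begin
      p ^ (m * s * (2 * ν + δ ∸ 2))   ≡⟨ cong (p ^_) (*-assoc m s _) ⟩
      p ^ (m * (s * (2 * ν + δ ∸ 2))) ≡⟨ p^m* (s * (2 * ν + δ ∸ 2)) ⟩
      q ^ (s * (2 * ν + δ ∸ 2))       ≡⟨ ^-*-assoc q s (2 * ν + δ ∸ 2) ⟨
      r ^ (2 * ν + δ ∸ 2)             ≡⟨ cong (r ^_) (exponent δ) ⟩
      r ^ (2 * suc w + δ)             ∎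

    c₁Param≡ : ∀ δ → c₁Param p s m ν δ ≡ u * P * r ^ (w + suc (w + 0) + δ)
    c₁Param≡ δ = begin
      (p ^ m ∸ 1) * p ^ (m * (s * (2 * ν + δ ∸ 2) ∸ 1))  ≡⟨ cong₂ _*_ p^m∸1 (p^m* _) ⟩
      u * q ^ (s * (2 * ν + δ ∸ 2) ∸ 1)                  ≡⟨ cong (λ e → u * q ^ (s * e ∸ 1)) (exponent δ) ⟩
      u * q ^ (s * (2 * suc w + δ) ∸ 1)                  ≡⟨ cong (u *_) (q^[s*e-1] (w + suc (w + 0) + δ)) ⟩
      u * (P * r ^ (w + suc (w + 0) + δ))                ≡⟨ *-assoc u P _ ⟨
      u * P * r ^ (w + suc (w + 0) + δ)                  ∎

    -- Both numbers are multiples of the positive `X`, by `u` and by `q = u + 1` respectively.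
    c₁≢c₂ : ∀ δ → c₁Param p s m ν δ ≢ c₂Param p s m ν δ
    c₁≢c₂ δ e = 1+n≢n (*-cancelʳ-≡ (suc u) u X {{>-nonZero X>0}} (begin
      q * X                          ≡⟨ *-assoc q P _ ⟨
      q * P * r ^ (w + suc (w + 0) + δ) ≡⟨ kParam≡ δ ⟨
      c₂Param p s m ν δ              ≡⟨ e ⟨
      c₁Param p s m ν δ              ≡⟨ c₁Param≡ δ ⟩
      u * P * r ^ (w + suc (w + 0) + δ) ≡⟨ *-assoc u P _ ⟩
      u * X                          ∎))
      where
      X = P * r ^ (w + suc (w + 0) + δ)
      X>0 : 0 < X
      X>0 = *-mono-≤ (m^n>0 q s′) (m^n>0 r {{m^n≢0 q s}} (w + suc (w + 0) + δ))

    nParam≡ : ∀ δ p-prime m≥1 → let open ResidueCounts u δ using (y) in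
      nParam p s m ν δ p-prime m≥1 ≡ P ^ (2 * suc w + δ) * y ν
    nParam≡ δ p-prime m≥1 = trans (/-congˡ {{pm-1-nonZero p m p-prime m≥1}} numerator)
      (m*n/n≡m (P ^ (2 * suc w + δ) * y ν) (p ^ m ∸ 1) {{pm-1-nonZero p m p-prime m≥1}})
      where
      open ResidueCounts u δ using (y; y-closed)
      Z = q ^ suc w * q ^ δ
      identity : ∀ a b c → a * b * c ≡ c * b * a
      identity = solve-∀
      numerator : (p ^ (m * ν) ∸ 1) * (p ^ (m * (ν + δ ∸ 1)) + 1) * p ^ (m * (s ∸ 1) * (2 * ν + δ ∸ 2)) ≡
        P ^ (2 * suc w + δ) * y ν * (p ^ m ∸ 1)
      numerator = begin
        (p ^ (m * ν) ∸ 1) * (p ^ (m * (ν + δ ∸ 1)) + 1) * p ^ (m * s′ * (2 * ν + δ ∸ 2))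
          ≡⟨ cong₂ _*_ (cong₂ (λ a b → (a ∸ 1) * (b + 1)) (p^m* ν)
               (trans (p^m* (suc w + δ)) (^-distribˡ-+-* q (suc w) δ)))
               (trans (cong (p ^_) (*-assoc m s′ _)) (p^m* _)) ⟩
        (q ^ ν ∸ 1) * (Z + 1) * q ^ (s′ * (2 * ν + δ ∸ 2))
          ≡⟨ cong₂ _*_ (m*n≡k+n⇒[m∸1]*n≡k {q ^ ν} {Z + 1} {u * y ν} (y-closed (suc w)))
               (trans (sym (^-*-assoc q s′ (2 * ν + δ ∸ 2))) (cong (P ^_) (exponent δ))) ⟩
        u * y ν * P ^ (2 * suc w + δ)
          ≡⟨ identity u (y ν) (P ^ (2 * suc w + δ)) ⟩
        P ^ (2 * suc w + δ) * y ν * u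
          ≡⟨ cong (P ^ (2 * suc w + δ) * y ν *_) p^m∸1 ⟨
        P ^ (2 * suc w + δ) * y ν * (p ^ m ∸ 1) ∎

    r^≡ : ∀ e → r ^ e ≡ q ^ e * P ^ e
    r^≡ e = ^-distribʳ-* e q P

    private module T δ = ResidueCounts u δ

    cancel-q : ∀ δ → T.t δ (suc w) + q ^ w * q ^ δ ≡ q * q ^ w + q * q ^ w * q ^ w * q ^ δ
    cancel-q δ = *-cancelˡ-≡ _ _ q (begin
      q * (T.t δ (suc w) + q ^ w * q ^ δ)   ≡⟨ left u (T.t δ (suc w)) (q ^ w) (q ^ δ) ⟩
      q * T.t δ (suc w) + q * q ^ w * q ^ δ ≡⟨ T.t-closed δ (suc w) ⟩
      q * (q * q ^ w) + q * q ^ w * (q * q ^ w) * q ^ δ ≡⟨ right u (q ^ w) (q ^ δ) ⟩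
      q * (q * q ^ w + q * q ^ w * q ^ w * q ^ δ) ∎)
      where
      left : ∀ u τ X D → (1 + u) * (τ + X * D) ≡ (1 + u) * τ + (1 + u) * X * D
      left = solve-∀
      right : ∀ u X D → (1 + u) * ((1 + u) * X) + (1 + u) * X * ((1 + u) * X) * D ≡ (1 + u) * ((1 + u) * X + (1 + u) * X * X * D)
      right = solve-∀

    private
      X : ℕ
      X = q ^ w

    q^2n : ∀ δ → q ^ (2 * suc w + δ) ≡ q * X * (q * X) * q ^ δ
    q^2n δ = T.q^2n+δ δ (suc w)

    q^[s*e-1]′ : ∀ e → q ^ (s * suc e ∸ 1) ≡ P ^ suc e * q ^ e
    q^[s*e-1]′ e = begin
      q ^ (s * suc e ∸ 1)   ≡⟨ q^[s*e-1] e ⟩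
      P * r ^ e             ≡⟨ cong (P *_) (trans (r^≡ e) (*-comm (q ^ e) (P ^ e))) ⟩
      P * (P ^ e * q ^ e)   ≡⟨ *-assoc P (P ^ e) (q ^ e) ⟨
      P ^ suc e * q ^ e     ∎

    -- With `l` the number of residue vectors at which the form does not vanish, `P ^ E * l` is the
    -- number of vectors over the ring with `Q` a unit. Each value of `δ` then only requires writing
    -- the stated λ as `P ^ E * l`.
    λ-from-residue : ∀ δ l → T.t δ (suc w) + l ≡ q * X * (q * X) * q ^ δ →
      P ^ (2 * suc w + δ) * T.t δ (suc w) + P ^ (2 * suc w + δ) * l ≡ r ^ (2 * suc w + δ)
    λ-from-residue δ l e = begin
      P ^ E * T.t δ (suc w) + P ^ E * l  ≡⟨ *-distribˡ-+ (P ^ E) _ l ⟨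
      P ^ E * (T.t δ (suc w) + l)        ≡⟨ cong (P ^ E *_) (trans e (sym (q^2n δ))) ⟩
      P ^ E * q ^ E                      ≡⟨ *-comm (P ^ E) (q ^ E) ⟩
      q ^ E * P ^ E                      ≡⟨ r^≡ E ⟨
      r ^ E                              ∎
      where E = 2 * suc w + δ

    lamParam≡ : ∀ {δ} → δ ≤ 2 →
      P ^ (2 * suc w + δ) * T.t δ (suc w) + lamParam p s m ν δ ≡ r ^ (2 * suc w + δ)
    lamParam≡ {0} _ = trans (cong (P ^ (2 * suc w + 0) * T.t 0 (suc w) +_) lam≡) (λ-from-residue 0 (u * (q * X * X ∸ X)) residue)
      where
      E = 2 * suc w + 0
      -- The first factor is the normal form of `2 * s ∸ 1`; the identity amounts to
      -- `(2s - 1) ν - 2s = 2 s′ (w + 1) + w`.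
      small : ∀ s′ w → (s′ + suc (s′ + 0)) * (2 + w) ≡ (s′ * (2 * suc w) + w) + 2 * suc s′
      small = solve-∀
      q^large : q ^ (w + suc (w + 0)) ≡ q * X * X
      q^large = trans (^-distribˡ-+-* q w (suc (w + 0))) (trans (cong (λ e → X * (q * q ^ e)) (+-identityʳ w)) (*-comm X (q * X)))
      lam≡ : lamParam p s m ν 0 ≡ P ^ E * (u * (q * X * X ∸ X))
      lam≡ = begin
        (p ^ m ∸ 1) * (p ^ (m * (s * (2 * ν ∸ 2) ∸ 1)) ∸ p ^ (m * ((2 * s ∸ 1) * ν ∸ 2 * s)))
          ≡⟨ cong₂ _*_ p^m∸1 (cong₂ _∸_ (p^m* _) (p^m* _)) ⟩
        u * (q ^ (s * (2 * ν ∸ 2) ∸ 1) ∸ q ^ ((2 * s ∸ 1) * ν ∸ 2 * s))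
          ≡⟨ cong₂ (λ a b → u * (q ^ (s * a ∸ 1) ∸ q ^ b)) (cong (_∸ 2) (double-suc (suc w)))
               (trans (cong (_∸ 2 * s) (small s′ w)) (m+n∸n≡m (s′ * (2 * suc w) + w) (2 * s))) ⟩
        u * (q ^ (s * (2 * suc w) ∸ 1) ∸ q ^ (s′ * (2 * suc w) + w))
          ≡⟨ cong₂ (λ a b → u * (a ∸ b)) (trans (q^[s*e-1]′ (w + suc (w + 0))) (cong (P ^ (2 * suc w) *_) q^large))
               (trans (^-distribˡ-+-* q (s′ * (2 * suc w)) w) (cong (_* X) (sym (^-*-assoc q s′ (2 * suc w))))) ⟩
        u * (P ^ (2 * suc w) * (q * X * X) ∸ P ^ (2 * suc w) * X)
          ≡⟨ cong (u *_) (*-distribˡ-∸ (P ^ (2 * suc w)) (q * X * X) X) ⟨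
        u * (P ^ (2 * suc w) * (q * X * X ∸ X))
          ≡⟨ cong (λ e → u * (P ^ e * (q * X * X ∸ X))) (+-identityʳ (2 * suc w)) ⟨
        u * (P ^ E * (q * X * X ∸ X))
          ≡⟨ *-left-comm u (P ^ E) _ ⟩
        P ^ E * (u * (q * X * X ∸ X)) ∎
        where
        *-left-comm : ∀ a b c → a * (b * c) ≡ b * (a * c)
        *-left-comm = solve-∀
      -- The stated λ for `δ = 0` contains a truncated difference; this inequality makes it a
      -- genuine one.
      X≤ : X ≤ q * X * X
      X≤ = m≤n*m X (q * X) {{m*n≢0 q X {{_}} {{m^n≢0 q w}}}}
      residue : T.t 0 (suc w) + u * (q * X * X ∸ X) ≡ q * X * (q * X) * 1
      -- Adding `X * 1` completes the left side of `cancel-q`, and adding `u * X` undoes the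
      -- subtraction in `d`.
      residue = +-cancelʳ-≡ (X * 1 + u * X) _ _ (begin
        τ + u * d + (X * 1 + u * X)          ≡⟨ left u τ d X ⟩
        τ + X * 1 + u * (d + X)              ≡⟨ cong₂ (λ a b → a + u * b) (cancel-q 0) (m∸n+n≡m X≤) ⟩
        q * X + q * X * X * 1 + u * (q * X * X) ≡⟨ right u X ⟩
        q * X * (q * X) * 1 + (X * 1 + u * X) ∎)
        where
        τ = T.t 0 (suc w)
        d = q * X * X ∸ X
        left : ∀ u τ d X → τ + u * d + (X * 1 + u * X) ≡ τ + X * 1 + u * (d + X)
        left = solve-∀
        right : ∀ u X → (1 + u) * X + (1 + u) * X * X * 1 + u * ((1 + u) * X * X) ≡ (1 + u) * X * ((1 + u) * X) * 1 + (X * 1 + u * X)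
        right = solve-∀
    lamParam≡ {1} _ = trans (cong (P ^ E * T.t 1 (suc w) +_) lam≡) (λ-from-residue 1 (u * (q * X * (q * X))) residue)
      where
      E = 2 * suc w + 1
      q^large : q ^ (w + suc (w + 0) + 1) ≡ q * X * (q * X)
      q^large = trans (cong (q ^_) (shape w)) (^-distribˡ-+-* q (suc w) (suc w))
        where
        shape : ∀ w → w + suc (w + 0) + 1 ≡ suc w + suc w
        shape = solve-∀
      2ν∸1 : 2 * ν ∸ 1 ≡ E
      2ν∸1 = trans (cong (_∸ 1) (double-suc (suc w))) (+-comm 1 (2 * suc w))
      lam≡ : lamParam p s m ν 1 ≡ P ^ E * (u * (q * X * (q * X)))
      lam≡ = begin
        (p ^ m ∸ 1) * p ^ (m * (s * (2 * ν ∸ 1) ∸ 1))   ≡⟨ cong₂ _*_ p^m∸1 (p^m* _) ⟩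
        u * q ^ (s * (2 * ν ∸ 1) ∸ 1)                   ≡⟨ cong (λ e → u * q ^ (s * e ∸ 1)) 2ν∸1 ⟩
        u * q ^ (s * E ∸ 1)                             ≡⟨ cong (u *_) (trans (q^[s*e-1]′ (w + suc (w + 0) + 1)) (cong (P ^ E *_) q^large)) ⟩
        u * (P ^ E * (q * X * (q * X)))                 ≡⟨ *-left-comm u (P ^ E) _ ⟩
        P ^ E * (u * (q * X * (q * X)))                 ∎
        where
        *-left-comm : ∀ a b c → a * (b * c) ≡ b * (a * c)
        *-left-comm = solve-∀
      residue : T.t 1 (suc w) + u * (q * X * (q * X)) ≡ q * X * (q * X) * (q * 1)
      residue = +-cancelʳ-≡ (X * (q * 1)) _ _ (begin
        τ + u * (q * X * (q * X)) + X * (q * 1)          ≡⟨ left τ (u * (q * X * (q * X))) (X * (q * 1)) ⟩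
        τ + X * (q * 1) + u * (q * X * (q * X))          ≡⟨ cong (_+ u * (q * X * (q * X))) (cancel-q 1) ⟩
        q * X + q * X * X * (q * 1) + u * (q * X * (q * X)) ≡⟨ right u X ⟩
        q * X * (q * X) * (q * 1) + X * (q * 1) ∎)
        where
        τ = T.t 1 (suc w)
        left : ∀ a b c → a + b + c ≡ a + c + b
        left = solve-∀
        right : ∀ u X → (1 + u) * X + (1 + u) * X * X * ((1 + u) * 1) + u * ((1 + u) * X * ((1 + u) * X)) ≡
          (1 + u) * X * ((1 + u) * X) * ((1 + u) * 1) + X * ((1 + u) * 1)
        right = solve-∀
    lamParam≡ {2} _ = trans (cong (P ^ E * T.t 2 (suc w) +_) lam≡) (λ-from-residue 2 (u * (q * X * (q * X) * q + q * X)) residue)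
      where
      E = 2 * suc w + 2
      2ν : 2 * ν ≡ E
      2ν = trans (double-suc (suc w)) (+-comm 2 (2 * suc w))
      q^large : q ^ (w + suc (w + 0) + 2) ≡ q * X * (q * X) * q
      q^large = trans (cong (q ^_) (shape w)) (trans (^-distribˡ-+-* q (suc w + suc w) 1)
        (cong₂ _*_ (^-distribˡ-+-* q (suc w) (suc w)) (*-identityʳ q)))
        where
        shape : ∀ w → w + suc (w + 0) + 2 ≡ suc w + suc w + 1
        shape = solve-∀
      small : 2 * s * ν ∸ 1 ∸ ν ≡ s′ * E + suc w
      small = trans (∸-+-assoc (2 * s * ν) 1 ν) (trans (cong (_∸ suc ν) (identity s′ w)) (m+n∸n≡m _ (suc ν)))
        where
        identity : ∀ s′ w → 2 * suc s′ * (2 + w) ≡ s′ * (2 * suc w + 2) + suc w + (3 + w)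
        identity = solve-∀
      lam≡ : lamParam p s m ν 2 ≡ P ^ E * (u * (q * X * (q * X) * q + q * X))
      lam≡ = begin
        (p ^ m ∸ 1) * (p ^ (m * (s * (2 * ν) ∸ 1)) + p ^ (m * (2 * s * ν ∸ 1 ∸ ν)))
          ≡⟨ cong₂ _*_ p^m∸1 (cong₂ _+_ (p^m* _) (p^m* _)) ⟩
        u * (q ^ (s * (2 * ν) ∸ 1) + q ^ (2 * s * ν ∸ 1 ∸ ν))
          ≡⟨ cong₂ (λ a b → u * (q ^ (s * a ∸ 1) + q ^ b)) 2ν small ⟩
        u * (q ^ (s * E ∸ 1) + q ^ (s′ * E + suc w))
          ≡⟨ cong₂ (λ a b → u * (a + b)) (trans (q^[s*e-1]′ (w + suc (w + 0) + 2)) (cong (P ^ E *_) q^large))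
               (trans (^-distribˡ-+-* q (s′ * E) (suc w)) (cong (_* (q * X)) (sym (^-*-assoc q s′ E)))) ⟩
        u * (P ^ E * (q * X * (q * X) * q) + P ^ E * (q * X))
          ≡⟨ factor u (P ^ E) (q * X * (q * X) * q) (q * X) ⟩
        P ^ E * (u * (q * X * (q * X) * q + q * X)) ∎
        where
        factor : ∀ a b c d → a * (b * c + b * d) ≡ b * (a * (c + d))
        factor = solve-∀
      residue : T.t 2 (suc w) + u * (q * X * (q * X) * q + q * X) ≡ q * X * (q * X) * (q * (q * 1))
      residue = +-cancelʳ-≡ (X * (q * (q * 1))) _ _ (begin
        τ + l + X * (q * (q * 1))          ≡⟨ left τ l (X * (q * (q * 1))) ⟩
        τ + X * (q * (q * 1)) + l          ≡⟨ cong (_+ l) (cancel-q 2) ⟩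
        q * X + q * X * X * (q * (q * 1)) + l ≡⟨ right u X ⟩
        q * X * (q * X) * (q * (q * 1)) + X * (q * (q * 1)) ∎)
        where
        τ = T.t 2 (suc w)
        l = u * (q * X * (q * X) * q + q * X)
        left : ∀ a b c → a + b + c ≡ a + c + b
        left = solve-∀
        right : ∀ u X → (1 + u) * X + (1 + u) * X * X * ((1 + u) * ((1 + u) * 1)) + u * ((1 + u) * X * ((1 + u) * X) * (1 + u) + (1 + u) * X) ≡
          (1 + u) * X * ((1 + u) * X) * ((1 + u) * ((1 + u) * 1)) + X * ((1 + u) * ((1 + u) * 1))
        right = solve-∀
    lamParam≡ {suc (suc (suc _))} (s≤s (s≤s ()))

open Arithmetic

-- Units, non-units and cardinalities in the Galois ring

module OverGaloisRing {c ℓ} (R : CommutativeRing c ℓ) (p s′ m : ℕ) (p-prime : Prime p) (p≢2 : p ≢ 2)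
  (galois : RingNotions.GaloisRing R p (suc s′) m) where

  open CommutativeRing R hiding (zero)
  open RingNotions R
  open GaloisRing galois
  open RingSolver R
  open import Algebra.Properties.Semiring.Mult semiring using (×1-homo-*)
  open import Relation.Binary.Reasoning.Setoid setoid
  open import Data.Vec.Functional.Relation.Binary.Equality.Setoid setoid using (_≋_; ≋-setoid; ≋-refl)
  open import Algebra.Properties.Group +-group using (x∙y⁻¹≈ε⇒x≈y; x≈y⇒x∙y⁻¹≈ε) renaming (∙-cancelˡ to +-cancelˡ; ∙-cancelʳ to +-cancelʳ)

  s : ℕ
  s = suc s′

  instance
    p-nonZero : ℕ.NonZero p
    p-nonZero = prime⇒nonZero p-prime

  π : Carrier
  π = natR p

  count-R : Count setoid U (p ℕ.^ (s ℕ.* m))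
  count-R = count-cong _ _ (mkCount cardinality)

  infix 4 _≟_
  _≟_ : ∀ x y → Dec (x ≈ y)
  x ≟ y = count-≟ count-R {x} {y} _ _

  Unit-resp : Unit Respects _≈_
  Unit-resp x≈y (u , e) = u , trans (*-congʳ (sym x≈y)) e

  Unit? : Decidable Unit
  Unit? x = map′ (λ (y , _ , e) → y , e) (λ (y , e) → y , _ , e)
    (count-any? (λ y → x * y ≟ 1#) (λ y≈y′ e → trans (*-congˡ (sym y≈y′)) e) count-R)

  Unit-* : ∀ {x y} → Unit x → Unit y → Unit (x * y)
  Unit-* {x} {y} (u , e) (v , f) = u * v , (begin
    x * y * (u * v)   ≈⟨ solve 4 (λ x y u v → x :* y :* (u :* v) := (x :* u) :* (y :* v)) refl x y u v ⟩
    (x * u) * (y * v) ≈⟨ *-cong e f ⟩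
    1# * 1#           ≈⟨ *-identityˡ 1# ⟩
    1#                ∎)

  Unit-1 : Unit 1#
  Unit-1 = 1# , *-identityˡ 1#

  Unit-factorʳ : ∀ {x y} → Unit (x * y) → Unit y
  Unit-factorʳ {x} {y} (u , e) = x * u , trans (solve 3 (λ x y u → y :* (x :* u) := x :* y :* u) refl x y u) e

  Unit-factorˡ : ∀ {x y} → Unit (x * y) → Unit x
  Unit-factorˡ {x} {y} = Unit-factorʳ ∘ Unit-resp (*-comm x y)

  Unit-cancelˡ : ∀ {u x y} → Unit u → u * x ≈ u * y → x ≈ y
  Unit-cancelˡ {u} {x} {y} (v , e) f = begin
    x           ≈⟨ *-identityˡ x ⟨
    1# * x      ≈⟨ *-congʳ e ⟨
    u * v * x   ≈⟨ solve 3 (λ u v x → u :* v :* x := v :* (u :* x)) refl u v x ⟩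
    v * (u * x) ≈⟨ *-congˡ f ⟩
    v * (u * y) ≈⟨ solve 3 (λ u v x → v :* (u :* x) := u :* v :* x) refl u v y ⟩
    u * v * y   ≈⟨ *-congʳ e ⟩
    1# * y      ≈⟨ *-identityˡ y ⟩
    y           ∎

  NonUnit : Carrier → Set _
  NonUnit x = ¬ Unit x

  NonUnit? : Decidable NonUnit
  NonUnit? x = ¬? (Unit? x)

  NonUnit-resp : NonUnit Respects _≈_
  NonUnit-resp x≈y ¬u = ¬u ∘ Unit-resp (sym x≈y)

  NonUnit⇒π∣ : ∀ {x} → NonUnit x → ∃ λ y → x ≈ π * y
  NonUnit⇒π∣ {x} = Equivalence.to (maximal-pR x)

  π∣⇒NonUnit : ∀ {x} y → x ≈ π * y → NonUnit x
  π∣⇒NonUnit {x} y e = Equivalence.from (maximal-pR x) (y , e)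

  NonUnit-+ : ∀ {x y} → NonUnit x → NonUnit y → NonUnit (x + y)
  NonUnit-+ nx ny with NonUnit⇒π∣ nx | NonUnit⇒π∣ ny
  ... | u , e | v , f = π∣⇒NonUnit (u + v) (trans (+-cong e f) (sym (distribˡ π u v)))

  NonUnit-*ʳ : ∀ {x} y → NonUnit x → NonUnit (x * y)
  NonUnit-*ʳ y nx = nx ∘ Unit-factorˡ

  NonUnit-*ˡ : ∀ x {y} → NonUnit y → NonUnit (x * y)
  NonUnit-*ˡ x ny = ny ∘ Unit-factorʳ

  NonUnit-neg : ∀ {x} → NonUnit x → NonUnit (- x)
  NonUnit-neg {x} nx = NonUnit-resp (solve 1 (λ x → x :* (:- :1) := :- x) refl x) (NonUnit-*ʳ (- 1#) nx)

  NonUnit-- : ∀ {x y} → NonUnit x → NonUnit y → NonUnit (x - y)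
  NonUnit-- nx ny = NonUnit-+ nx (NonUnit-neg ny)

  NonUnit-0 : NonUnit 0#
  NonUnit-0 = π∣⇒NonUnit 0# (sym (zeroʳ π))

  NonUnit-π : NonUnit π
  NonUnit-π = π∣⇒NonUnit 1# (sym (*-identityʳ π))

  NonUnit-product : ∀ {x y} → Unit x → NonUnit (x * y) → NonUnit y
  NonUnit-product ux nxy uy = nxy (Unit-* ux uy)

  Unit+NonUnit : ∀ {x y} → Unit x → NonUnit y → Unit (x + y)
  Unit+NonUnit {x} {y} ux ny = decidable-stable (Unit? _) λ n →
    NonUnit-resp (solve 2 (λ x y → x :+ y :- y := x) refl x y) (NonUnit-- n ny) ux

  NonUnit-+-cancelʳ : ∀ {x y} → NonUnit y → NonUnit (x + y) → NonUnit x
  NonUnit-+-cancelʳ ny nxy ux = nxy (Unit+NonUnit ux ny)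

  2# : Carrier
  2# = 1# + 1#

  odd : ∃ λ k → p ≡ 1 ℕ.+ k ℕ.* 2
  odd with p ℕ.% 2 in e | ℕ.m%n<n p 2 | ℕ.m≡m%n+[m/n]*n p 2
  ... | 0 | _ | _ with prime⇒irreducible p-prime (ℕ.m%n≡0⇒n∣m p 2 e)
  ...    | inj₂ 2≡p = ⊥-elim (p≢2 (≡.sym 2≡p))
  odd | 1 | _ | f = p ℕ./ 2 , f
  odd | suc (suc _) | s≤s (s≤s ()) | _

  abstract
    -- As `p` is odd, `π = 1 + 2k`; if 2 were a non-unit, then so would be `1 = π - 2k`.
    Unit-2 : Unit 2#
    Unit-2 = decidable-stable (Unit? 2#) λ n2 → NonUnit-+-cancelʳ
      (NonUnit-*ˡ (natR (proj₁ odd)) n2)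
      (NonUnit-resp π≈ NonUnit-π) Unit-1
      where
      π≈ : π ≈ 1# + natR (proj₁ odd) * 2#
      π≈ = begin
        natR p                                   ≡⟨ ≡.cong natR (proj₂ odd) ⟩
        1# + natR (proj₁ odd ℕ.* 2)              ≈⟨ +-congˡ (×1-homo-* (proj₁ odd) 2) ⟩
        1# + natR (proj₁ odd) * (1# + (1# + 0#)) ≈⟨ +-congˡ (*-congˡ (+-congˡ (+-identityʳ 1#))) ⟩
        1# + natR (proj₁ odd) * 2#               ∎

  ½ : Carrier
  ½ = proj₁ Unit-2

  2*½ : 2# * ½ ≈ 1#
  2*½ = proj₂ Unit-2

  ½*2 : ∀ x → ½ * (2# * x) ≈ x
  ½*2 x = begin
    ½ * (2# * x) ≈⟨ solve 2 (λ h x → h :* (:2 :* x) := :2 :* h :* x) refl ½ x ⟩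
    2# * ½ * x   ≈⟨ *-congʳ 2*½ ⟩
    1# * x       ≈⟨ *-identityˡ x ⟩
    x            ∎

  2*½* : ∀ x → 2# * (½ * x) ≈ x
  2*½* x = trans (sym (*-assoc 2# ½ x)) (trans (*-congʳ 2*½) (*-identityˡ x))

  π^ : ℕ → Carrier
  π^ i = natR (p ℕ.^ i)

  π^≉0 : ∀ {i} → i < s → ¬ (π^ i ≈ 0#)
  π^≉0 {i} i<s = char-minimal (p ℕ.^ i) (ℕₚ.m^n>0 p i)
    (ℕₚ.^-monoʳ-< p (ℕ.nonTrivial⇒n>1 p {{prime⇒nonTrivial p-prime}}) i<s)

  π^-suc : ∀ i → π^ (suc i) ≈ π^ i * π
  π^-suc i = trans (×1-homo-* p (p ℕ.^ i)) (*-comm π (π^ i))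

  -- R modulo the annihilator of π^ i, which has the same cardinality as the ideal of multiples of π^ i.
  R/ann : ℕ → Setoid c ℓ
  R/ann i = record
    { Carrier = Carrier ; _≈_ = λ x y → π^ i * x ≈ π^ i * y
    ; isEquivalence = record { refl = refl ; sym = sym ; trans = trans } }

  ≡π-isEquivalence : IsEquivalence (λ x y → NonUnit (x - y))
  ≡π-isEquivalence = record
    { refl  = λ {x} → NonUnit-resp (sym (-‿inverseʳ x)) NonUnit-0
    ; sym   = λ {x} {y} n → NonUnit-resp (solve 2 (λ x y → :- (x :- y) := y :- x) refl x y) (NonUnit-neg n)
    ; trans = λ {x} {y} {z} n n′ → NonUnit-resp
        (solve 3 (λ x y z → (x :- y) :+ (y :- z) := x :- z) refl x y z) (NonUnit-+ n n′) }

  R/π : Setoid c _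
  R/π = record { isEquivalence = ≡π-isEquivalence }

  ≈⇒≡π : ∀ {x y} → x ≈ y → NonUnit (x - y)
  ≈⇒≡π {x} {y} e = NonUnit-resp (sym (trans (+-congʳ e) (-‿inverseʳ y))) NonUnit-0

  -- A unit `x - y` could be cancelled, leaving `π^ i = 0` against the minimality of the
  -- characteristic.
  π^-cancel : ∀ {i x y} → i < s → π^ i * x ≈ π^ i * y → NonUnit (x - y)
  π^-cancel {i} {x} {y} i<s e ux = π^≉0 i<s (Unit-cancelˡ ux (begin
    (x - y) * π^ i          ≈⟨ solve 3 (λ x y z → (x :- y) :* z := z :* x :- z :* y) refl x y (π^ i) ⟩
    π^ i * x - π^ i * y     ≈⟨ +-congʳ e ⟩
    π^ i * y - π^ i * y     ≈⟨ -‿inverseʳ _ ⟩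
    0#                      ≈⟨ zeroʳ _ ⟨
    (x - y) * 0#            ∎))

  abstract
    residueCount : ∃ (Count R/π U)
    residueCount = count-quotient ≡π-isEquivalence (λ x y → NonUnit? (x - y)) ≈⇒≡π count-R

  q : ℕ
  q = proj₁ residueCount

  -- For `i < s` the quotient `R/ann i` maps onto the residue field. The fibre over `x` consists of
  -- the elements `x + π t`, where `t` matters only modulo the annihilator of `π^ (i + 1)`, so each
  -- step contributes one factor `q`.
  count-R/ann : ∀ j i → i ℕ.+ j ≡ s → Count (R/ann i) U (q ℕ.^ j)
  count-R/ann zero i e = count-one 0# _ λ y _ → begin
    π^ i * y  ≈⟨ *-congʳ π^i≈0 ⟩
    0# * y    ≈⟨ zeroˡ y ⟩
    0#        ≈⟨ zeroʳ _ ⟨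
    π^ i * 0# ∎
    where
    π^i≈0 : π^ i ≈ 0#
    π^i≈0 = ≡.subst (λ i → π^ i ≈ 0#) (≡.trans (≡.sym e) (ℕₚ.+-identityʳ i)) char-zero
  count-R/ann (suc j) i e = count-fibres id (π^-cancel i<s) _ fibre (proj₂ residueCount)
    where
    i<s : i < s
    i<s = ≡.subst (i <_) e (ℕₚ.m<m+n i ℕₚ.0<1+n)
    expand : ∀ x t → π^ i * (x + π * t) ≈ π^ i * x + π^ (suc i) * t
    expand x t = begin
      π^ i * (x + π * t)        ≈⟨ solve 4 (λ a b x t → a :* (x :+ b :* t) := a :* x :+ a :* b :* t) refl (π^ i) π x t ⟩
      π^ i * x + π^ i * π * t   ≈⟨ +-congˡ (*-congʳ (π^-suc i)) ⟨
      π^ i * x + π^ (suc i) * t ∎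
    fibre : ∀ x → U x → Count (R/ann i) (λ y → U y × NonUnit (y - x)) (q ℕ.^ j)
    fibre x _ = count-map (λ t → x + π * t)
      (λ {t} {t′} f → trans (expand x t) (trans (+-congˡ f) (sym (expand x t′))))
      (λ t _ → _ , π∣⇒NonUnit t (solve 3 (λ x b t → x :+ b :* t :- x := b :* t) refl x π t))
      (λ {t} {t′} _ _ f → +-cancelˡ (π^ i * x) _ _ (trans (sym (expand x t)) (trans f (expand x t′))))
      (λ y (_ , n) → let t , f = NonUnit⇒π∣ n in t , _ , *-congˡ (begin
         y           ≈⟨ solve 2 (λ x y → y := x :+ (y :- x)) refl x y ⟩
         x + (y - x) ≈⟨ +-congˡ f ⟩
         x + π * t   ∎))
      (count-R/ann j (suc i) (≡.trans (≡.sym (ℕₚ.+-suc i j)) e))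

  π^0≈1 : π^ 0 ≈ 1#
  π^0≈1 = +-identityʳ 1#

  q^s : q ℕ.^ s ≡ p ℕ.^ (s ℕ.* m)
  q^s = count-unique (count-map id
      (λ e → trans (sym (1* _)) (trans e (1* _))) (λ _ → id) (λ _ _ e → *-congˡ e)
      (λ y _ → y , _ , refl) (count-R/ann s 0 ≡.refl)) count-R
    where
    1* : ∀ x → π^ 0 * x ≈ x
    1* x = trans (*-congʳ π^0≈1) (*-identityˡ x)

  q^s≡[p^m]^s : q ℕ.^ s ≡ (p ℕ.^ m) ℕ.^ s
  q^s≡[p^m]^s = ≡.trans q^s (≡.trans (≡.cong (p ℕ.^_) (ℕₚ.*-comm s m)) (≡.sym (ℕₚ.^-*-assoc p m s)))

  -- `GaloisRing` prescribes the cardinality of the ring, not that of its residue field. The latter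
  -- is recovered from `q^s = (p^m)^s` because `s`-th powers are strictly increasing.
  q≡p^m : q ≡ p ℕ.^ m
  q≡p^m with ℕₚ.<-cmp q (p ℕ.^ m)
  ... | tri< lt _ _ = ⊥-elim (ℕₚ.<⇒≢ (ℕₚ.^-monoˡ-< s lt) q^s≡[p^m]^s)
  ... | tri≈ _ e _  = e
  ... | tri> _ _ gt = ⊥-elim (ℕₚ.<⇒≢ (ℕₚ.^-monoˡ-< s gt) (≡.sym q^s≡[p^m]^s))

  r : ℕ
  r = q ℕ.^ s

  count-all : Count setoid U r
  count-all = ≡.subst (Count setoid U) (≡.sym q^s) count-R

  nonUnits : ℕ
  nonUnits = q ℕ.^ s′

  count-NonUnit : Count setoid NonUnit nonUnits
  count-NonUnit = count-map (π *_)
    (λ e → trans (*-congʳ (sym π^1≈π)) (trans e (*-congʳ π^1≈π)))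
    (λ x _ → π∣⇒NonUnit x refl)
    (λ _ _ e → trans (*-congʳ π^1≈π) (trans e (*-congʳ (sym π^1≈π))))
    (λ y n → let x , e = NonUnit⇒π∣ n in x , _ , e)
    (count-R/ann s′ 1 ≡.refl)
    where
    π^1≈π : π^ 1 ≈ π
    π^1≈π = trans (π^-suc 0) (trans (*-congʳ π^0≈1) (*-identityˡ π))

  abstract
    unitCount : ∃ λ u → Count setoid (λ x → U x × ¬ NonUnit x) u × nonUnits ℕ.+ u ≡ r
    unitCount = count-∖ NonUnit? NonUnit-resp count-all (count-cong (λ _ n → _ , n) (λ _ → proj₂) count-NonUnit)

  units : ℕ
  units = proj₁ unitCount

  count-Unit : Count setoid Unit units
  count-Unit = count-cong (λ x (_ , nn) → decidable-stable (Unit? x) nn) (λ _ u → _ , λ n → n u) (proj₁ (proj₂ unitCount))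

  nonUnits+units : nonUnits ℕ.+ units ≡ r
  nonUnits+units = proj₂ (proj₂ unitCount)

  -- Hensel's lemma for squares: t ↦ t (2 u + t) is injective, hence surjective, on the non-units.
  lift-square : ∀ {u z} → Unit u → NonUnit (z - u * u) → ∃ λ y → y * y ≈ z
  lift-square {u} {z} uu n =
    let t , _ , e = injective⇒surjective _≟_ NonUnit-resp count-NonUnit (λ t → t * (2# * u + t))
                      (λ e → *-cong e (+-congˡ e)) (λ t → NonUnit-*ʳ _) inj (z - u * u) n
    in u + t , (begin
      (u + t) * (u + t)           ≈⟨ solve 2 (λ u t → (u :+ t) :* (u :+ t) := u :* u :+ t :* (:2 :* u :+ t)) refl u t ⟩
      u * u + t * (2# * u + t)    ≈⟨ +-congˡ e ⟩
      u * u + (z - u * u)         ≈⟨ solve 2 (λ v z → v :+ (z :- v) := z) refl (u * u) z ⟩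
      z                           ∎)
    where
    inj : ∀ {x y} → NonUnit x → NonUnit y → x * (2# * u + x) ≈ y * (2# * u + y) → x ≈ y
    inj {x} {y} nx ny e = x∙y⁻¹≈ε⇒x≈y x y (Unit-cancelˡ
      (Unit+NonUnit (Unit-* Unit-2 uu) (NonUnit-+ nx ny)) (begin
        (2# * u + (x + y)) * (x - y)
          ≈⟨ solve 3 (λ u x y → (:2 :* u :+ (x :+ y)) :* (x :- y) := x :* (:2 :* u :+ x) :- y :* (:2 :* u :+ y)) refl u x y ⟩
        x * (2# * u + x) - y * (2# * u + y) ≈⟨ x≈y⇒x∙y⁻¹≈ε e ⟩
        0#                                  ≈⟨ zeroʳ _ ⟨
        (2# * u + (x + y)) * 0#             ∎))

  count-vector : ∀ {q} {P : Carrier → Set q} {n} k → Count setoid P n →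
    Count (≋-setoid k) (λ v → ∀ i → P (v i)) (n ℕ.^ k)
  count-vector zero    _   = count-one (λ ()) (λ ()) (λ _ _ ())
  count-vector (suc k) cnt = count-map (λ (x , v) → x Vector.∷ v)
    (λ { (e , _) zero → e ; (_ , e) (suc i) → e i })
    (λ { _ (px , _) zero → px ; _ (_ , pv) (suc i) → pv i })
    (λ _ _ e → e zero , e ∘ suc)
    (λ v pv → (v zero , v ∘ suc) , (pv zero , pv ∘ suc) , λ { zero → refl ; (suc i) → refl })
    (count-× cnt (count-vector k cnt))

  count-vectors : ∀ k → Count (≋-setoid k) U (r ℕ.^ k)
  count-vectors k = count-cong _ _ (count-vector k count-all)

  count-affine : ∀ {q} {X : Carrier → Set q} {n w} → X Respects _≈_ → Unit w → ∀ k →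
    Count setoid X n → Count setoid (λ x → X (w * x + k)) n
  count-affine {w = w} resp (w⁻¹ , e) k = count-map (λ x → w⁻¹ * (x - k))
    (λ x≈y → *-congˡ (+-congʳ x≈y))
    (λ x → resp (sym (cancel x)))
    (λ {x} {y} _ _ f → trans (sym (cancel x)) (trans (+-congʳ (*-congˡ f)) (cancel y)))
    (λ y xy → w * y + k , xy , (begin
       y                         ≈⟨ *-identityˡ y ⟨
       1# * y                    ≈⟨ *-congʳ e ⟨
       w * w⁻¹ * y               ≈⟨ solve 4 (λ w v y k → w :* v :* y := v :* (w :* y :+ k :- k)) refl w w⁻¹ y k ⟩
       w⁻¹ * (w * y + k - k)     ∎))
    where
    cancel : ∀ x → w * (w⁻¹ * (x - k)) + k ≈ x
    cancel x = begin
      w * (w⁻¹ * (x - k)) + k   ≈⟨ solve 4 (λ w v x k → w :* (v :* (x :- k)) :+ k := w :* v :* (x :- k) :+ k) refl w w⁻¹ x k ⟩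
      w * w⁻¹ * (x - k) + k     ≈⟨ +-congʳ (*-congʳ e) ⟩
      1# * (x - k) + k          ≈⟨ solve 2 (λ x k → :1 :* (x :- k) :+ k := x) refl x k ⟩
      x                         ∎

  ≈-resp : ∀ c → (_≈ c) Respects _≈_
  ≈-resp c x≈y x≈c = trans (sym x≈y) x≈c

  count-≈ : ∀ c → Count setoid (_≈ c) 1
  count-≈ c = count-one c refl (λ _ → id)

  -- The data carried along the recursion over hyperbolic planes. One number `zeros` serves all
  -- non-unit `c`, because the step replaces `c` by `c - 2ab` with varying non-units `a` and `b`.
  record QuadraticSet : Set (lsuc (c ⊔ ℓ)) where
    field
      points    : Setoid c ℓ
    open Setoid points public using () renaming (Carrier to Point; _≈_ to _≈ᵖ_)
    field
      Q         : Point → Carrier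
      Q-cong    : ∀ {x y} → x ≈ᵖ y → Q x ≈ Q y
      Primitive : Point → Set (c ⊔ ℓ)
      size singular zeros : ℕ
      count-size      : Count points U size
      count-singular  : Count points (λ x → NonUnit (Q x)) singular
      count-primitive : ∀ c → NonUnit c → Count points (λ x → Primitive x × Q x ≈ c) zeros

  hyperbolic : QuadraticSet → QuadraticSet
  hyperbolic X = record
    { points    = setoid ×ₛ (setoid ×ₛ points)
    ; Q         = Q′
    ; Q-cong    = Q′-cong
    ; Primitive = Primitive′
    ; count-size      = count-cong _ _ (count-× count-all (count-× count-all count-size))
    ; count-singular  = count-split (λ (a , _) → Unit? a) (λ (e , _) → Unit-resp e) singular₁ singular₂
    ; count-primitive = λ c nc → count-split (λ (a , _) → Unit? a) (λ (e , _) → Unit-resp e) (primitive₁ c nc)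
        (count-split (λ (_ , b , _) → Unit? b) (λ (_ , e , _) → Unit-resp e) (primitive₂ c nc) (primitive₃ c nc))
    }
    where
    open QuadraticSet X
    Q′ : Carrier × Carrier × Point → Carrier
    Q′ (a , b , x) = 2# * (a * b) + Q x

    Q′-cong : ∀ {x y} → Setoid._≈_ (setoid ×ₛ (setoid ×ₛ points)) x y → Q′ x ≈ Q′ y
    Q′-cong (e , f , g) = +-cong (*-congˡ (*-cong e f)) (Q-cong g)

    Primitive′ : Carrier × Carrier × Point → Set _
    Primitive′ (a , b , x) = Unit a ⊎ Unit b ⊎ Primitive x

    linearʳ : ∀ a b k → 2# * a * b + k ≈ 2# * (a * b) + k
    linearʳ = solve 3 (λ a b k → :2 :* a :* b :+ k := :2 :* (a :* b) :+ k) refl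

    linearˡ : ∀ a b k → 2# * b * a + k ≈ 2# * (a * b) + k
    linearˡ = solve 3 (λ a b k → :2 :* b :* a :+ k := :2 :* (a :* b) :+ k) refl

    solutionsʳ : ∀ {q} {X : Carrier → Set q} {n a} k → X Respects _≈_ → Unit a →
      Count setoid X n → Count setoid (λ b → X (2# * (a * b) + k)) n
    solutionsʳ {a = a} k resp ua cnt =
      count-cong (λ b → resp (linearʳ a b k)) (λ b → resp (sym (linearʳ a b k)))
        (count-affine resp (Unit-* Unit-2 ua) k cnt)

    solutionsˡ : ∀ {q} {X : Carrier → Set q} {n b} k → X Respects _≈_ → Unit b →
      Count setoid X n → Count setoid (λ a → X (2# * (a * b) + k)) n
    solutionsˡ {b = b} k resp ub cnt =
      count-cong (λ a → resp (linearˡ a b k)) (λ a → resp (sym (linearˡ a b k)))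
        (count-affine resp (Unit-* Unit-2 ub) k cnt)

    NonUnit-Q : ∀ {a b x} → NonUnit (a * b) → NonUnit (Q′ (a , b , x)) → NonUnit (Q x)
    NonUnit-Q {a} {b} {x} nab n = NonUnit-+-cancelʳ (NonUnit-*ˡ 2# nab) (NonUnit-resp (+-comm _ (Q x)) n)

    NonUnit-2ab : ∀ {a b x} → NonUnit (Q x) → NonUnit (Q′ (a , b , x)) → NonUnit (a * b)
    NonUnit-2ab nq n = NonUnit-product Unit-2 (NonUnit-+-cancelʳ nq n)

    -- For a unit `a` the map `b ↦ 2ab + Q x` is an affine bijection of the ring, so `b` is counted
    -- last and the coordinates are regrouped as `((a , x) , b)`.
    singular₁ : Count _ (λ (a , b , x) → NonUnit (Q′ (a , b , x)) × Unit a) ((units ℕ.* size) ℕ.* nonUnits)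
    singular₁ = count-map (λ ((a , x) , b) → a , b , x)
      (λ ((e , g) , f) → e , f , g)
      (λ _ ((ua , _) , n) → n , ua)
      (λ _ _ (e , f , g) → (e , g) , f)
      (λ (a , b , x) (n , ua) → ((a , x) , b) , ((ua , _) , n) , Setoid.refl (setoid ×ₛ (setoid ×ₛ points)))
      (count-Σ (λ (e , g) → NonUnit-resp (Q′-cong (e , refl , g)))
        (count-× count-Unit count-size)
        (λ (a , x) (ua , _) → solutionsʳ (Q x) NonUnit-resp ua count-NonUnit))

    singular₂ : Count _ (λ (a , b , x) → NonUnit (Q′ (a , b , x)) × NonUnit a) (nonUnits ℕ.* (r ℕ.* singular))
    singular₂ = count-cong
      (λ (a , b , x) (na , _ , n) → NonUnit-+ (NonUnit-*ˡ 2# (NonUnit-*ʳ b na)) n , na)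
      (λ (a , b , x) (n , na) → na , _ , NonUnit-Q (NonUnit-*ʳ b na) n)
      (count-× count-NonUnit (count-× count-all count-singular))

    primitive₁ : ∀ c → NonUnit c → Count _ (λ (a , b , x) → (Primitive′ (a , b , x) × Q′ (a , b , x) ≈ c) × Unit a)
      ((units ℕ.* size) ℕ.* 1)
    primitive₁ c nc = count-map (λ ((a , x) , b) → a , b , x)
      (λ ((e , g) , f) → e , f , g)
      (λ _ ((ua , _) , e) → (inj₁ ua , e) , ua)
      (λ _ _ (e , f , g) → (e , g) , f)
      (λ (a , b , x) ((_ , e) , ua) → ((a , x) , b) , ((ua , _) , e) , Setoid.refl (setoid ×ₛ (setoid ×ₛ points)))
      (count-Σ (λ (e , g) → ≈-resp c (Q′-cong (e , refl , g)))
        (count-× count-Unit count-size)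
        (λ (a , x) (ua , _) → solutionsʳ (Q x) (≈-resp c) ua (count-≈ c)))

    -- Here `a` is solved for. As `c` and `2ab` are non-units, `Q x` has to be one; conversely, for
    -- such `x` the solution `a` is automatically a non-unit.
    primitive₂ : ∀ c → NonUnit c →
      Count _ (λ (a , b , x) → ((Primitive′ (a , b , x) × Q′ (a , b , x) ≈ c) × NonUnit a) × Unit b)
        ((units ℕ.* singular) ℕ.* 1)
    primitive₂ c nc = count-map (λ ((b , x) , a) → a , b , x)
      (λ ((e , g) , f) → f , e , g)
      (λ ((b , x) , a) ((ub , nq) , e) → ((inj₂ (inj₁ ub) , e) ,
         NonUnit-product ub (NonUnit-resp (*-comm a b) (NonUnit-2ab nq (NonUnit-resp (sym e) nc)))) , ub)
      (λ _ _ (e , f , g) → (f , g) , e)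
      (λ (a , b , x) (((_ , e) , na) , ub) → ((b , x) , a) ,
         ((ub , NonUnit-Q (NonUnit-*ʳ b na) (NonUnit-resp (sym e) nc)) , e) , Setoid.refl (setoid ×ₛ (setoid ×ₛ points)))
      (count-Σ (λ (e , g) → ≈-resp c (Q′-cong (refl , e , g)))
        (count-× count-Unit count-singular)
        (λ (b , x) (ub , _) → solutionsˡ (Q x) (≈-resp c) ub (count-≈ c)))

    -- With `a` and `b` non-units, primitivity has to come from `x`, and the new right-hand side
    -- `c - 2ab` is again a non-unit.
    primitive₃ : ∀ c → NonUnit c →
      Count _ (λ (a , b , x) → ((Primitive′ (a , b , x) × Q′ (a , b , x) ≈ c) × NonUnit a) × NonUnit b)
        ((nonUnits ℕ.* nonUnits) ℕ.* zeros)
    primitive₃ c nc = count-map (λ ((a , b) , x) → a , b , x)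
      (λ ((e , f) , g) → e , f , g)
      (λ ((a , b) , x) ((na , nb) , px , e) → ((inj₂ (inj₂ px) , (begin
         2# * (a * b) + Q x                  ≈⟨ +-congˡ e ⟩
         2# * (a * b) + (c - 2# * (a * b))   ≈⟨ solve 2 (λ t c → t :+ (c :- t) := c) refl _ c ⟩
         c                                   ∎)) , na) , nb)
      (λ _ _ (e , f , g) → (e , f) , g)
      (λ (a , b , x) (((pr , e) , na) , nb) → ((a , b) , x) , ((na , nb) , prim na nb pr , (begin
         Q x                                  ≈⟨ solve 2 (λ t q → q := t :+ q :- t) refl (2# * (a * b)) (Q x) ⟩
         2# * (a * b) + Q x - 2# * (a * b)    ≈⟨ +-congʳ e ⟩
         c - 2# * (a * b)                     ∎)) , Setoid.refl (setoid ×ₛ (setoid ×ₛ points)))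
      (count-Σ (λ (e , f) (px , h) → px , trans h (+-congˡ (-‿cong (*-congˡ (*-cong e f)))))
        (count-× count-NonUnit count-NonUnit)
        (λ (a , b) (na , nb) → count-primitive (c - 2# * (a * b)) (NonUnit-- nc (NonUnit-*ˡ 2# (NonUnit-*ˡ a nb)))))
      where
      prim : ∀ {a b x} → NonUnit a → NonUnit b → Primitive′ (a , b , x) → Primitive x
      prim na nb (inj₁ ua)        = ⊥-elim (na ua)
      prim na nb (inj₂ (inj₁ ub)) = ⊥-elim (nb ub)
      prim na nb (inj₂ (inj₂ px)) = px

  -- The recursion starts at a form that is a non-unit exactly on the vectors with all coordinates
  -- in the maximal ideal; primitive vectors never take a non-unit value, whence `zeros` starts at
  -- 0.
  module Anisotropic (δ : ℕ) (Q : (Fin δ → Carrier) → Carrier) (Q-cong : ∀ {v w} → v ≋ w → Q v ≈ Q w)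
    (anisotropic : ∀ v → NonUnit (Q v) → ∀ i → NonUnit (v i))
    (singular    : ∀ v → (∀ i → NonUnit (v i)) → NonUnit (Q v)) where

    base : QuadraticSet
    base = record
      { points    = ≋-setoid δ
      ; Q         = Q
      ; Q-cong    = Q-cong
      ; Primitive = λ v → ∃ λ i → Unit (v i)
      ; count-size      = count-vectors δ
      ; count-singular  = count-cong singular anisotropic (count-vector δ count-NonUnit)
      ; count-primitive = λ c nc → count-∅ λ v ((i , u) , e) → anisotropic v (NonUnit-resp (sym e) nc) i u
      }

    tower : ℕ → QuadraticSet
    tower zero    = base
    tower (suc ν) = hyperbolic (tower ν)

  q>0 : 0 ℕ.< q
  q>0 = ≡.subst (0 ℕ.<_) (≡.sym q≡p^m) (ℕₚ.m^n>0 p m)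

  instance
    q-nonZero : ℕ.NonZero q
    q-nonZero = ℕ.>-nonZero q>0
    r-nonZero : ℕ.NonZero r
    r-nonZero = ℕₚ.m^n≢0 q s
    nonUnits-nonZero : ℕ.NonZero nonUnits
    nonUnits-nonZero = ℕₚ.m^n≢0 q s′

  -- Counting vectors in a non-degenerate bilinear space

  module Vectors (N N′ : ℕ) (N≡ : N ≡ 3 ℕ.+ N′) where
    V : Set c
    V = Fin N → Carrier

    infixl 6 _+[_]_
    infixr 7 _·_
    _+[_]_ : V → Carrier → V → V
    (v +[ t ] w) i = v i + t * w i

    _·_ : Carrier → V → V
    (t · v) i = t * v i

    module BilinearSpace (B : V → V → Carrier)
      (B-congʳ : ∀ {u v w} → v ≋ w → B u v ≈ B u w)
      (B-sym : ∀ v w → B v w ≈ B w v)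
      (B-+ʳ : ∀ u v t w → B u (v +[ t ] w) ≈ B u v + t * B u w)
      (B-·ʳ : ∀ u t v → B u (t · v) ≈ t * B u v)
      (f : Fin N → V) (dual : ∀ v i → B v (f i) ≈ v i) where

      Q : V → Carrier
      Q v = B v v

      B-congˡ : ∀ {u v w} → v ≋ w → B v u ≈ B w u
      B-congˡ {u} {v} {w} e = trans (B-sym v u) (trans (B-congʳ e) (B-sym u w))

      Q-cong : ∀ {v w} → v ≋ w → Q v ≈ Q w
      Q-cong e = trans (B-congˡ e) (B-congʳ e)

      B-·ˡ : ∀ t v u → B (t · v) u ≈ t * B v u
      B-·ˡ t v u = trans (B-sym _ u) (trans (B-·ʳ u t v) (*-congˡ (B-sym u v)))

      Q-+ : ∀ v t w → Q (v +[ t ] w) ≈ Q v + t * (2# * B w v + t * Q w)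
      Q-+ v t w = begin
        B (v +[ t ] w) (v +[ t ] w)                           ≈⟨ B-+ʳ _ v t w ⟩
        B (v +[ t ] w) v + t * B (v +[ t ] w) w               ≈⟨ +-cong (expand v) (*-congˡ (expand w)) ⟩
        (Q v + t * B v w) + t * (B w v + t * Q w)             ≈⟨ +-congʳ (+-congˡ (*-congˡ (B-sym v w))) ⟩
        (Q v + t * B w v) + t * (B w v + t * Q w)
          ≈⟨ solve 4 (λ a t b d → a :+ t :* b :+ t :* (b :+ t :* d) := a :+ t :* (:2 :* b :+ t :* d)) refl (Q v) t (B w v) (Q w) ⟩
        Q v + t * (2# * B w v + t * Q w)                      ∎
        where
        expand : ∀ u → B (v +[ t ] w) u ≈ B u v + t * B u w
        expand u = trans (B-sym _ u) (B-+ʳ u v t w)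

      Q-· : ∀ t v → Q (t · v) ≈ t * (t * Q v)
      Q-· t v = trans (B-·ˡ t v _) (*-congˡ (B-·ʳ v t v))

      -- `T` is the set of admissible translation lengths. It is the whole ring except in
      -- `count-one-sided`, where only non-unit translations preserve the condition `C`.
      module _ {γ τ ξ} {C : V → Set γ} {T : Carrier → Set τ} {X : Carrier → Set ξ} (d : V) (g : V → Carrier)
        (g-cong : ∀ {v w} → v ≋ w → g v ≈ g w)
        (g-shift : ∀ v t → C v → g (v +[ t ] d) ≈ g v + t)
        (T-neg : ∀ {t} → T t → T (- t)) (closed : ∀ v t → C v → T t → C (v +[ t ] d))
        (X-resp : X Respects _≈_) (X⇒T : ∀ t → X t → T t) where

        count-shift : ∀ {n k} → Count setoid X n → Count (≋-setoid N) (λ v → C v × g v ≈ 0#) k →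
          Count (≋-setoid N) (λ v → C v × X (g v)) (n ℕ.* k)
        count-shift cX cG = count-map (λ (t , v) → v +[ t ] d)
          (λ (e , f) i → +-cong (f i) (*-congʳ e))
          (λ (t , v) (xt , cv , e) → closed v t cv (X⇒T t xt) , X-resp (sym (level t v cv e)) xt)
          (λ {(t , v)} {(t′ , v′)} (xt , cv , e) (xt′ , cv′ , e′) h →
             let t≈t′ = trans (sym (level t v cv e)) (trans (g-cong h) (level t′ v′ cv′ e′)) in
             t≈t′ , λ i → +-cancelʳ (t * d i) _ _ (trans (h i) (+-congˡ (*-congʳ (sym t≈t′)))))
          (λ v (cv , x) → (g v , v +[ - g v ] d) ,
             (x , closed v _ cv (T-neg (X⇒T _ x)) , trans (g-shift v (- g v) cv) (-‿inverseʳ (g v))) ,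
             λ i → solve 3 (λ a b c → a := a :+ :- b :* c :+ b :* c) refl (v i) (g v) (d i))
          (count-× cX cG)
          where
          level : ∀ t v → C v → g v ≈ 0# → g (v +[ t ] d) ≈ t
          level t v cv e = trans (g-shift v t cv) (trans (+-congʳ e) (+-identityˡ t))

        -- The converse of `count-shift`: the zero part of `g` has some number of elements because
        -- the space is finite, and cancelling the positive factor `n` determines it.
        count-unshift : ∀ {n k} .{{_ : ℕ.NonZero n}} → Decidable C → C Respects _≋_ →
          Count setoid X n → Count (≋-setoid N) (λ v → C v × X (g v)) (n ℕ.* k) →
          Count (≋-setoid N) (λ v → C v × g v ≈ 0#) k
        count-unshift {n} {k} C? C-resp cX cC = ≡.subst (Count (≋-setoid N) _)
          (ℕₚ.*-cancelˡ-≡ _ k n (count-unique (count-shift cX (proj₂ small)) cC)) (proj₂ small)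
          where
          small : ∃ (Count (≋-setoid N) (λ v → C v × g v ≈ 0#))
          small = _ , count-cong (λ _ → proj₂) (λ _ x → _ , x)
            (proj₂ (count-filter (λ v → C? v ×-dec (g v ≟ 0#))
              (λ e (cv , h) → C-resp e cv , trans (sym (g-cong e)) h) (count-vectors N)))

      -- Three factors are split off because a common neighbour is subject to three conditions: on
      -- `B x v`, on `B y v` and on `Q v`.
      r^N : r ℕ.^ N ≡ r ℕ.* (r ℕ.* (r ℕ.* r ℕ.^ N′))
      r^N = ≡.cong (r ℕ.^_) N≡

      B-shift : ∀ {x d} → B x d ≈ 1# → ∀ k v t → B x (v +[ t ] d) - k ≈ B x v - k + t
      B-shift {x} {d} e k v t = begin
        B x (v +[ t ] d) - k    ≈⟨ +-congʳ (B-+ʳ x v t d) ⟩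
        B x v + t * B x d - k   ≈⟨ +-congʳ (+-congˡ (*-congˡ e)) ⟩
        B x v + t * 1# - k      ≈⟨ solve 3 (λ a t k → a :+ t :* :1 :- k := a :- k :+ t) refl (B x v) t k ⟩
        B x v - k + t           ∎

      B-orthogonal : ∀ {x d} → B x d ≈ 0# → ∀ v t → B x (v +[ t ] d) ≈ B x v
      B-orthogonal {x} {d} e v t = begin
        B x (v +[ t ] d)    ≈⟨ B-+ʳ x v t d ⟩
        B x v + t * B x d   ≈⟨ +-congˡ (trans (*-congˡ e) (zeroʳ t)) ⟩
        B x v + 0#          ≈⟨ +-identityʳ _ ⟩
        B x v               ∎

      -- On the hyperplane `B x v = 1` the value `Q v` changes by `2t`; the factor `½` normalises
      -- this to the unit speed that `count-shift` requires.
      ½Q-shift : ∀ {x} → Q x ≈ 0# → ∀ v t → B x v ≈ 1# → ½ * Q (v +[ t ] x) ≈ ½ * Q v + t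
      ½Q-shift {x} Qx≈0 v t e = begin
        ½ * Q (v +[ t ] x)                        ≈⟨ *-congˡ (Q-+ v t x) ⟩
        ½ * (Q v + t * (2# * B x v + t * Q x))    ≈⟨ *-congˡ (+-congˡ (*-congˡ (+-cong (*-congˡ e) (*-congˡ Qx≈0)))) ⟩
        ½ * (Q v + t * (2# * 1# + t * 0#))
          ≈⟨ solve 3 (λ h a t → h :* (a :+ t :* (:2 :* :1 :+ t :* :0)) := h :* a :+ h :* (:2 :* t)) refl ½ (Q v) t ⟩
        ½ * Q v + ½ * (2# * t)                    ≈⟨ +-congˡ (½*2 t) ⟩
        ½ * Q v + t                               ∎

      ½Q-cong : ∀ {v w} → v ≋ w → ½ * Q v ≈ ½ * Q w
      ½Q-cong e = *-congˡ (Q-cong e)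

      ½≈0⇒ : ∀ {x} → ½ * x ≈ 0# → x ≈ 0#
      ½≈0⇒ {x} e = trans (sym (2*½* x)) (trans (*-congˡ e) (zeroʳ 2#))

      ≈0⇒½ : ∀ {x} → x ≈ 0# → ½ * x ≈ 0#
      ≈0⇒½ e = trans (*-congˡ e) (zeroʳ ½)

      module _ {x : V} (∃d : ∃ λ d → B x d ≈ 1#) where

        count-hyperplane : Count (≋-setoid N) (λ v → B x v ≈ 1#) (r ℕ.* (r ℕ.* r ℕ.^ N′))
        count-hyperplane = count-cong (λ v (_ , e) → x∙y⁻¹≈ε⇒x≈y _ _ e) (λ v e → _ , x≈y⇒x∙y⁻¹≈ε e)
          (count-unshift {C = U} {T = U} {X = U} (proj₁ ∃d) (λ v → B x v - 1#)
            (λ e → +-congʳ (B-congʳ e)) (λ v t _ → B-shift (proj₂ ∃d) 1# v t) _ _ _ _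
            (λ _ → yes _) _ count-all
            (≡.subst (Count _ _) r^N (count-cong _ _ (count-vectors N))))

        -- Translation along `x` stays in the hyperplane because `B x x = 0`; `E` is any further
        -- condition that survives this translation.
        count-isotropic : ∀ {γ} {E : V → Set γ} {k} → Q x ≈ 0# → Decidable E → E Respects _≋_ →
          (∀ v t → E v → E (v +[ t ] x)) →
          Count (≋-setoid N) (λ v → B x v ≈ 1# × E v) (r ℕ.* k) →
          Count (≋-setoid N) (λ v → (B x v ≈ 1# × E v) × Q v ≈ 0#) k
        count-isotropic {E = E} Qx≈0 E? E-resp E-closed cnt =
          count-cong (λ _ (h , e) → h , ½≈0⇒ e) (λ _ (h , e) → h , ≈0⇒½ e)
          (count-unshift {C = λ v → B x v ≈ 1# × E v} {T = U} {X = U} x (λ v → ½ * Q v)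
            ½Q-cong (λ v t (e , _) → ½Q-shift Qx≈0 v t e) _
            (λ v t (e , h) _ → trans (B-orthogonal Qx≈0 v t) e , E-closed v t h) _ _
            (λ v → (B x v ≟ 1#) ×-dec E? v)
            (λ e (f , h) → trans (sym (B-congʳ e)) f , E-resp e h) count-all
            (count-cong (λ _ h → h , _) (λ _ → proj₁) cnt))

        count-neighbours : Q x ≈ 0# → Count (≋-setoid N) (λ v → B x v ≈ 1# × Q v ≈ 0#) (r ℕ.* r ℕ.^ N′)
        count-neighbours Qx≈0 = count-cong (λ _ ((e , _) , h) → e , h) (λ _ (e , h) → (e , _) , h)
          (count-isotropic {E = U} Qx≈0 (λ _ → yes _) _ _ (count-cong (λ _ e → e , _) (λ _ → proj₁) count-hyperplane))

        module _ {y e : V} (Bxe : B x e ≈ 0#) (Bye : B y e ≈ 1#) where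

          -- Translation along `e` moves `B y v` and fixes `B x v`, so all values of `B y v` are
          -- equally frequent on the hyperplane. `count-unshift` finds the common frequency, and
          -- `count-shift` multiplies it by the size of `X`.
          count-independent : ∀ {ξ} {X : Carrier → Set ξ} {n} → X Respects _≈_ → Count setoid X n →
            Count (≋-setoid N) (λ v → B x v ≈ 1# × X (B y v)) (n ℕ.* (r ℕ.* r ℕ.^ N′))
          count-independent resp cX = count-cong
            (λ v (h , xt) → h , resp (x-0≈x _) xt) (λ v (h , xt) → h , resp (sym (x-0≈x _)) xt)
            (count-shift {T = U} e g g-cong (λ v t _ → g-shift v t) _ closed resp _ cX
              (count-unshift {C = λ v → B x v ≈ 1#} {T = U} {X = U} e g g-cong (λ v t _ → g-shift v t) _ closed _ _
                (λ v → B x v ≟ 1#) (λ h h′ → trans (sym (B-congʳ h)) h′) count-all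
                (count-cong (λ _ h → h , _) (λ _ → proj₁) count-hyperplane)))
            where
            g : V → Carrier
            -- The subtraction of zero brings `g` into the shape of `B-shift`; `x-0≈x` removes it
            -- afterwards.
            g v = B y v - 0#
            g-cong : ∀ {v w} → v ≋ w → g v ≈ g w
            g-cong h = +-congʳ (B-congʳ h)
            g-shift : ∀ v t → g (v +[ t ] e) ≈ g v + t
            g-shift = B-shift Bye 0#
            closed : ∀ v t → B x v ≈ 1# → U t → B x (v +[ t ] e) ≈ 1#
            closed v t h _ = trans (B-orthogonal Bxe v t) h
            x-0≈x : ∀ a → a - 0# ≈ a
            x-0≈x = solve 1 (λ a → a :- :0 := a) refl

          count-common-independent : Q x ≈ 0# → NonUnit (B y x) →
            Count (≋-setoid N) (λ v → (B x v ≈ 1# × Unit (B y v)) × Q v ≈ 0#) (units ℕ.* r ℕ.^ N′)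
          count-common-independent Qx≈0 n = count-isotropic Qx≈0 (λ v → Unit? (B y v)) (λ h → Unit-resp (B-congʳ h))
            (λ v t u → Unit-resp (sym (B-+ʳ y v t x)) (Unit+NonUnit u (NonUnit-*ˡ t n)))
            (≡.subst (Count _ _) units-r (count-independent Unit-resp count-Unit))
            where
            units-r : units ℕ.* (r ℕ.* r ℕ.^ N′) ≡ r ℕ.* (units ℕ.* r ℕ.^ N′)
            units-r = x∙yz≈y∙xz units r (r ℕ.^ N′)
              where open import Algebra.Properties.CommutativeSemigroup ℕₚ.*-commutativeSemigroup using (x∙yz≈y∙xz)

      -- The assumed total is the recursion for singular vectors over one hyperbolic plane: `t`
      -- counts those of rank `N - 2`, where there are `r * r ^ N′` vectors altogether. It mentions
      -- neither `x` nor `y`; the module recovers `t` from it as the number of normalised neighbours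
      -- of `x` that are not adjacent to `y`.
      module HyperbolicPair {x y : V} (Qx≈0 : Q x ≈ 0#) (Qy≈0 : Q y ≈ 0#) (Bxy≈1 : B x y ≈ 1#)
        (t : ℕ) (count-singular : Count (≋-setoid N) (λ v → NonUnit (Q v))
           (units ℕ.* (r ℕ.* r ℕ.^ N′) ℕ.* nonUnits ℕ.+ nonUnits ℕ.* (r ℕ.* t))) where

        Byx≈1 : B y x ≈ 1#
        Byx≈1 = trans (B-sym y x) Bxy≈1

        NonUnit-½ : ∀ {a} → NonUnit (½ * a) → NonUnit a
        NonUnit-½ = NonUnit-product (2# , trans (*-comm ½ 2#) 2*½)

        count-singular-hyperplane : Count (≋-setoid N) (λ v → B y v ≈ 1# × NonUnit (Q v)) (nonUnits ℕ.* (r ℕ.* r ℕ.^ N′))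
        count-singular-hyperplane =
          count-cong (λ _ (e , n) → e , NonUnit-½ n) (λ _ (e , n) → e , NonUnit-*ˡ ½ n)
          (count-shift {C = λ v → B y v ≈ 1#} {T = U} {X = NonUnit} y (λ v → ½ * Q v)
            ½Q-cong (½Q-shift Qy≈0) _
            (λ v t e _ → trans (B-orthogonal Qy≈0 v t) e) NonUnit-resp _ count-NonUnit
            (count-cong (λ _ (h , e) → h , ≈0⇒½ e) (λ _ (h , e) → h , ½≈0⇒ e) (count-neighbours (x , Byx≈1) Qy≈0)))

        -- A vector with `B y v` a unit is a unique unit multiple of one with `B y v = 1`, and unit
        -- scaling does not affect whether `Q v` is a unit.
        count-singular-unit : Count (≋-setoid N) (λ v → NonUnit (Q v) × Unit (B y v)) (units ℕ.* (nonUnits ℕ.* (r ℕ.* r ℕ.^ N′)))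
        count-singular-unit = count-map (λ (u , v) → u · v)
          (λ (e , f) i → *-cong e (f i))
          (λ (u , v) (uu , e , n) → NonUnit-resp (sym (Q-· u v)) (NonUnit-*ˡ u (NonUnit-*ˡ u n)) ,
             Unit-resp (sym (level u v e)) uu)
          (λ {(u , v)} {(u′ , v′)} (uu , e , n) (uu′ , e′ , n′) h →
             let u≈u′ = trans (sym (level u v e)) (trans (B-congʳ h) (level u′ v′ e′)) in
             u≈u′ , λ i → Unit-cancelˡ uu (trans (h i) (*-congʳ (sym u≈u′))))
          (λ v (n , u@(a , e)) → (B y v , a · v) ,
             (u , trans (B-·ʳ y a v) (trans (*-comm a _) e) ,
               NonUnit-resp (sym (Q-· a v)) (NonUnit-*ˡ a (NonUnit-*ˡ a n))) ,
             λ i → begin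
               v i                ≈⟨ *-identityˡ _ ⟨
               1# * v i           ≈⟨ *-congʳ e ⟨
               B y v * a * v i    ≈⟨ *-assoc _ _ _ ⟩
               B y v * (a * v i)  ∎)
          (count-× count-Unit count-singular-hyperplane)
          where
          level : ∀ u v → B y v ≈ 1# → B y (u · v) ≈ u
          level u v e = trans (B-·ʳ y u v) (trans (*-congˡ e) (*-identityʳ u))

        count-tangent : Count (≋-setoid N) (λ v → NonUnit (Q v) × NonUnit (B y v)) (r ℕ.* (nonUnits ℕ.* t))
        count-tangent = ≡.subst (Count (≋-setoid N) _) (ℕₚ.+-cancelˡ-≡ (units ℕ.* (nonUnits ℕ.* (r ℕ.* r ℕ.^ N′))) _ _
            (≡.trans (proj₂ (proj₂ rest)) rearrange)) (proj₁ (proj₂ rest))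
          where
          rest = count-∖ (λ v → Unit? (B y v)) (λ e → Unit-resp (B-congʳ e)) count-singular count-singular-unit
          open import Algebra.Properties.CommutativeSemigroup ℕₚ.*-commutativeSemigroup using (x∙yz≈y∙xz)
          -- The first summand of the assumed total is the count of `count-singular-unit`, so it
          -- cancels.
          rearrange : units ℕ.* (r ℕ.* r ℕ.^ N′) ℕ.* nonUnits ℕ.+ nonUnits ℕ.* (r ℕ.* t) ≡
            units ℕ.* (nonUnits ℕ.* (r ℕ.* r ℕ.^ N′)) ℕ.+ r ℕ.* (nonUnits ℕ.* t)
          rearrange = ≡.cong₂ ℕ._+_
            (≡.trans (ℕₚ.*-assoc units (r ℕ.* r ℕ.^ N′) nonUnits)
                     (≡.cong (units ℕ.*_) (ℕₚ.*-comm (r ℕ.* r ℕ.^ N′) nonUnits)))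
            (x∙yz≈y∙xz nonUnits r t)

        Tangent : V → Set (c ⊔ ℓ)
        Tangent v = NonUnit (Q v) × NonUnit (B y v)

        Tangent? : Decidable Tangent
        Tangent? v = NonUnit? (Q v) ×-dec NonUnit? (B y v)

        Tangent-resp : Tangent Respects _≋_
        Tangent-resp e (n , n′) = NonUnit-resp (Q-cong e) n , NonUnit-resp (B-congʳ e) n′

        -- When `B y v` is a non-unit, translation along `y` changes `Q v` by a non-unit and fixes
        -- `B y v`, while `B x v` runs through all values; this divides the count by `r`.
        count-tangent-hyperplane : Count (≋-setoid N) (λ v → Tangent v × B x v ≈ 1#) (nonUnits ℕ.* t)
        count-tangent-hyperplane =
          count-cong (λ v (h , e) → h , x∙y⁻¹≈ε⇒x≈y _ _ e) (λ v (h , e) → h , x≈y⇒x∙y⁻¹≈ε e)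
          (count-unshift {C = Tangent} {T = U} {X = U} y (λ v → B x v - 1#)
            (λ e → +-congʳ (B-congʳ e)) (λ v t _ → B-shift Bxy≈1 1# v t) _
            (λ v t (n , n′) _ →
               NonUnit-resp (sym (Q-+ v t y)) (NonUnit-+ n (NonUnit-*ˡ t (NonUnit-+ (NonUnit-*ˡ 2# n′)
                 (NonUnit-*ˡ t (NonUnit-resp (sym Qy≈0) NonUnit-0))))) ,
               NonUnit-resp (sym (B-orthogonal Qy≈0 v t)) n′) _ _
            Tangent? Tangent-resp count-all
            (count-cong (λ _ h → h , _) (λ _ → proj₁) count-tangent))

        -- Translation along `x` changes `B y v` by a multiple of `t`, which is harmless for
        -- non-unit `t`. On this set `½ Q v` takes only non-unit values, each equally often, so
        -- dividing by their number leaves the isotropic vectors.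
        count-one-sided : Count (≋-setoid N) (λ v → (B x v ≈ 1# × Q v ≈ 0#) × NonUnit (B y v)) t
        count-one-sided =
          count-cong (λ v ((h , e) , f) → (e , ½≈0⇒ f) , proj₂ h)
            (λ v ((e , f) , n) → ((NonUnit-resp (sym f) NonUnit-0 , n) , e) , ≈0⇒½ f)
          (count-unshift {C = λ v → Tangent v × B x v ≈ 1#} {T = NonUnit} {X = NonUnit} x (λ v → ½ * Q v)
            ½Q-cong (λ v t (_ , e) → ½Q-shift Qx≈0 v t e) NonUnit-neg
            (λ v t ((n , n′) , e) nt →
               (NonUnit-resp (sym (Q-+ v t x)) (NonUnit-+ n (NonUnit-*ʳ _ nt)) ,
                NonUnit-resp (sym (B-+ʳ y v t x)) (NonUnit-+ n′ (NonUnit-*ʳ _ nt))) ,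
               trans (B-orthogonal Qx≈0 v t) e) NonUnit-resp (λ _ n → n)
            (λ v → Tangent? v ×-dec (B x v ≟ 1#))
            (λ e (h , f) → Tangent-resp e h , trans (sym (B-congʳ e)) f) count-NonUnit
            (count-cong (λ v h@((n , _) , _) → h , NonUnit-*ˡ ½ n) (λ _ → proj₁) count-tangent-hyperplane))

        count-common-hyperbolic : ∃ λ k →
          Count (≋-setoid N) (λ v → (B x v ≈ 1# × Unit (B y v)) × Q v ≈ 0#) k × t ℕ.+ k ≡ r ℕ.* r ℕ.^ N′
        count-common-hyperbolic = _ ,
          count-cong (λ v ((e , f) , nn) → (e , decidable-stable (Unit? _) nn) , f)
            (λ v ((e , u) , f) → (e , f) , λ n → n u) (proj₁ (proj₂ rest)) ,
          proj₂ (proj₂ rest)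
          where
          rest = count-∖ (λ v → NonUnit? (B y v)) (λ e → NonUnit-resp (B-congʳ e))
                   (count-neighbours (y , Bxy≈1) Qx≈0) count-one-sided

      infix 4 _~_
      -- This relation, `Vertex` and `Adj` agree definitionally with those of `Orthogonal` once `B`
      -- is `form`, so the counts carry over without conversion.
      _~_ : V → V → Set (c ⊔ ℓ)
      α ~ β = ∃ λ u → Unit u × (∀ i → β i ≈ u * α i)

      ≋⇒~ : ∀ {v w} → v ≋ w → v ~ w
      ≋⇒~ e = 1# , Unit-1 , λ i → trans (sym (e i)) (sym (*-identityˡ _))

      Unit-inverse : ∀ {u} (uu : Unit u) → Unit (proj₁ uu)
      Unit-inverse {u} (a , e) = u , trans (*-comm a u) e

      inverse-cancel : ∀ {u} (uu : Unit u) x → x ≈ proj₁ uu * (u * x)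
      inverse-cancel {u} (a , e) x = begin
        x           ≈⟨ *-identityˡ x ⟨
        1# * x      ≈⟨ *-congʳ e ⟨
        u * a * x   ≈⟨ solve 3 (λ u a x → u :* a :* x := a :* (u :* x)) refl u a x ⟩
        a * (u * x) ∎

      ~-isEquivalence : IsEquivalence _~_
      ~-isEquivalence = record
        { refl  = ≋⇒~ ≋-refl
        ; sym   = λ (u , uu , e) → proj₁ uu , Unit-inverse uu ,
            λ i → trans (inverse-cancel uu _) (*-congˡ (sym (e i)))
        ; trans = λ (u , uu , e) (v , uv , f) → v * u , Unit-* uv uu ,
            λ i → trans (f i) (trans (*-congˡ (e i)) (sym (*-assoc v u _))) }

      _~?_ : ∀ v w → Dec (v ~ w)
      v ~? w = count-any? (λ u → all? (λ i → w i ≟ u * v i)) (λ h e i → trans (e i) (*-congʳ h)) count-Unit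

      Projective : Setoid c (c ⊔ ℓ)
      Projective = record { isEquivalence = ~-isEquivalence }

      Vertex : V → Set (c ⊔ ℓ)
      Vertex v = (∃ λ i → Unit (v i)) × Q v ≈ 0#

      NonUnit-B : ∀ {v} u → (∀ i → NonUnit (v i)) → NonUnit (B u v)
      NonUnit-B {v} u n = π∣⇒NonUnit (B u w) (trans (B-congʳ (λ i → proj₂ (NonUnit⇒π∣ (n i)))) (B-·ʳ u π w))
        where
        w : V
        w i = proj₁ (NonUnit⇒π∣ (n i))

      Unit-B⇒primitive : ∀ {u v} → Unit (B u v) → ∃ λ i → Unit (v i)
      Unit-B⇒primitive {u} {v} uB = decidable-stable (any? (λ i → Unit? (v i)))
        λ none → NonUnit-B u (λ i ui → none (i , ui)) uB

      primitive⇒dual : ∀ {x} → (∃ λ i → Unit (x i)) → ∃ λ d → B x d ≈ 1#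
      primitive⇒dual {x} (i , a , e) = a · f i , trans (B-·ʳ x a (f i)) (trans (*-congˡ (dual x i)) (trans (*-comm a _) e))

      -- A class of neighbours of `x` has only one representative with `B x v = 1`: the scalar `u`
      -- between two of them satisfies `u = u * B x v = B x w = 1`.
      count-classes : ∀ {γ} {E : V → Set γ} {x k} → (∀ u v → Unit u → E v → E (u · v)) →
        Count (≋-setoid N) (λ v → (B x v ≈ 1# × E v) × Q v ≈ 0#) k →
        Count Projective (λ v → Vertex v × Unit (B x v) × E v) k
      count-classes {x = x} E-scale = count-map id ≋⇒~
        (λ v ((e , h) , f) → (Unit-B⇒primitive (1-unit e) , f) , 1-unit e , h)
        (λ {v} {w} ((e , _) , _) ((e′ , _) , _) (u , _ , f) i → sym (begin
           w i      ≈⟨ f i ⟩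
           u * v i  ≈⟨ *-congʳ (begin
             u          ≈⟨ *-identityʳ u ⟨
             u * 1#     ≈⟨ *-congˡ e ⟨
             u * B x v  ≈⟨ B-·ʳ x u v ⟨
             B x (u · v) ≈⟨ B-congʳ f ⟨
             B x w       ≈⟨ e′ ⟩
             1#          ∎) ⟩
           1# * v i ≈⟨ *-identityˡ _ ⟩
           v i ∎))
        (λ w ((_ , f) , uB@(a , e) , h) → a · w ,
           ((trans (B-·ʳ x a w) (trans (*-comm a _) e) , E-scale a w (Unit-inverse uB) h) ,
            trans (Q-· a w) (trans (*-congˡ (trans (*-congˡ f) (zeroʳ a))) (zeroʳ a))) ,
           a , Unit-inverse uB , λ _ → refl)
        where
        1-unit : ∀ {v} → B x v ≈ 1# → Unit (B x v)
        1-unit e = Unit-resp (sym e) Unit-1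

      -- Double counting: one coordinate of a vertex is a unit, so the units act freely and every
      -- class has `units` representatives. This fixes the number of classes, which `count-quotient`
      -- only shows to exist.
      count-vertices : ∀ {w} → Count (≋-setoid N) Vertex w → ∃ λ n → Count Projective Vertex n × n ℕ.* units ≡ w
      count-vertices cnt = _ , proj₂ classes , count-unique (count-fibres id ≋⇒~ (λ _ → id) fibre (proj₂ classes)) cnt
        where
        classes = count-quotient ~-isEquivalence _~?_ ≋⇒~ cnt
        fibre : ∀ x → Vertex x → Count (≋-setoid N) (λ y → Vertex y × y ~ x) units
        fibre x ((i , ui) , Qx≈0) = count-map (_· x) (λ e i → *-congʳ e)
          (λ u uu → ((i , Unit-* uu ui) , trans (Q-· u x) (trans (*-congˡ (trans (*-congˡ Qx≈0) (zeroʳ u))) (zeroʳ u))) ,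
             IsEquivalence.sym ~-isEquivalence (u , uu , λ _ → refl))
          (λ {u} {v} _ _ e → Unit-cancelˡ ui (trans (*-comm _ u) (trans (e i) (*-comm v _))))
          (λ y (_ , y~x) → let u , uu , e = IsEquivalence.sym ~-isEquivalence y~x in u , uu , e)
          count-Unit

      -- `congruent` stands for proportionality modulo `π`; what it records is the resulting
      -- inclusion of neighbourhoods, by which the common neighbours are all the neighbours of `x`.
      data Position (x y : V) : Set (c ⊔ ℓ) where
        independent : ∀ {e} → B x e ≈ 0# → B y e ≈ 1# → Position x y
        congruent   : (∀ w → Unit (B x w) → Unit (B y w)) → Position x y

      -- Fix a unit coordinate `x i` and consider the minors `x i * y j - x j * y i`. A unit minor
      -- yields a functional that vanishes at `x` but not at `y`; if there is none, then `x i · y`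
      -- and `y i · x` agree modulo `π`.
      position : ∀ {x y} → (∃ λ i → Unit (x i)) → (∃ λ i → Unit (y i)) → Position x y
      position {x} {y} (i , ui) (k , uk) with any? (λ j → Unit? (x i * y j - x j * y i))
      -- Pairing `v` with this witness gives `b (x i * v j - x j * v i)`, where `b` inverts the unit
      -- minor.
      ... | yes (j , b , e) = independent {e = (b * x i) · f j +[ - (b * x j) ] f i}
        (begin
          B x ((b * x i) · f j +[ - (b * x j) ] f i)     ≈⟨ pairing x ⟩
          (b * x i) * x j + - (b * x j) * x i            ≈⟨ solve 3 (λ b p q → (b :* p) :* q :+ :- (b :* q) :* p := :0) refl b (x i) (x j) ⟩
          0#                                             ∎)
        (begin
          B y ((b * x i) · f j +[ - (b * x j) ] f i)     ≈⟨ pairing y ⟩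
          (b * x i) * y j + - (b * x j) * y i
            ≈⟨ solve 5 (λ b xi xj yi yj → (b :* xi) :* yj :+ :- (b :* xj) :* yi := (xi :* yj :- xj :* yi) :* b) refl b (x i) (x j) (y i) (y j) ⟩
          (x i * y j - x j * y i) * b                    ≈⟨ e ⟩
          1#                                             ∎)
        where
        pairing : ∀ v → B v ((b * x i) · f j +[ - (b * x j) ] f i) ≈ (b * x i) * v j + - (b * x j) * v i
        pairing v = trans (B-+ʳ v _ _ (f i)) (+-cong (trans (B-·ʳ v _ (f j)) (*-congˡ (dual v j))) (*-congˡ (dual v i)))
      ... | no none = congruent λ w u → Unit-factorʳ {x i} (Unit-resp (combine w)
              (Unit+NonUnit (Unit-* uyi u) (NonUnit-B w minor)))
        where
        minor : ∀ j → NonUnit (((x i) · y +[ - y i ] x) j)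
        minor j u = none (j , Unit-resp (solve 4 (λ xi xj yi yj → xi :* yj :+ :- yi :* xj := xi :* yj :- xj :* yi) refl (x i) (x j) (y i) (y j)) u)
        -- Otherwise the minor at the unit coordinate `y k` would be a unit plus a non-unit.
        uyi : Unit (y i)
        uyi = decidable-stable (Unit? (y i)) λ nyi →
          minor k (Unit+NonUnit (Unit-* ui uk) (NonUnit-*ʳ _ (NonUnit-neg nyi)))
        combine : ∀ w → y i * B x w + B w ((x i) · y +[ - y i ] x) ≈ x i * B y w
        combine w = begin
          y i * B x w + B w ((x i) · y +[ - y i ] x)             ≈⟨ +-cong (*-congˡ (B-sym x w)) (trans (B-+ʳ w _ _ x) (+-congʳ (B-·ʳ w (x i) y))) ⟩
          y i * B w x + (x i * B w y + - y i * B w x)            ≈⟨ solve 4 (λ p q r s → p :* q :+ (r :* s :+ :- p :* q) := r :* s) refl (y i) (B w x) (x i) (B w y) ⟩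
          x i * B w y                                            ≈⟨ *-congˡ (B-sym w y) ⟩
          x i * B y w                                            ∎

      Adj : V → V → Set (c ⊔ ℓ)
      Adj x y = Unit (B x y)

      module Graph (t : ℕ) (count-singular : Count (≋-setoid N) (λ v → NonUnit (Q v))
           (units ℕ.* (r ℕ.* r ℕ.^ N′) ℕ.* nonUnits ℕ.+ nonUnits ℕ.* (r ℕ.* t))) where

        regular : ∀ x → Vertex x → Count Projective (λ y → Vertex y × Unit (B x y)) (r ℕ.* r ℕ.^ N′)
        regular x (h , Qx≈0) = (count-cong (λ _ (v , a , _) → v , a) (λ _ (v , a) → v , a , _)
          (count-classes {E = U} (λ _ _ _ _ → _)
            (count-cong (λ _ (e , f) → (e , _) , f) (λ _ ((e , _) , f) → e , f)
              (count-neighbours (primitive⇒dual h) Qx≈0))))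

        Unit-B-scale : ∀ y u v → Unit u → Unit (B y v) → Unit (B y (u · v))
        Unit-B-scale y u v uu uB = Unit-resp (sym (B-·ʳ y u v)) (Unit-* uu uB)

        -- Replacing `y` by its multiple `a · y` makes the pairing with `x` equal to 1 and does not
        -- affect whether the pairing with `v` is a unit, so `HyperbolicPair` applies.
        adjacent : ∀ x y → Vertex x → Vertex y → Unit (B x y) →
          ∃ λ k → Count Projective (λ v → Vertex v × Unit (B x v) × Unit (B y v)) k × t ℕ.+ k ≡ r ℕ.* r ℕ.^ N′
        adjacent x y (_ , Qx≈0) (_ , Qy≈0) xy@(a , e) = unscale (HyperbolicPair.count-common-hyperbolic {x} {a · y} Qx≈0
            (trans (Q-· a y) (trans (*-congˡ (trans (*-congˡ Qy≈0) (zeroʳ a))) (zeroʳ a)))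
            (trans (B-·ʳ x a y) (trans (*-comm a _) e))
            t count-singular)
          where
          unscale : (∃ λ k → Count (≋-setoid N) (λ v → (B x v ≈ 1# × Unit (B (a · y) v)) × Q v ≈ 0#) k × t ℕ.+ k ≡ r ℕ.* r ℕ.^ N′) →
            ∃ λ k → Count Projective (λ v → Vertex v × Unit (B x v) × Unit (B y v)) k × t ℕ.+ k ≡ r ℕ.* r ℕ.^ N′
          unscale (k , cnt , t+k≡) = k , count-classes {E = λ v → Unit (B y v)} (Unit-B-scale y)
            (count-cong (λ v ((h , u) , f) → (h , Unit-factorʳ {a} {B y v} (Unit-resp (B-·ˡ a y v) u)) , f)
                        (λ v ((h , u) , f) → (h , Unit-resp (sym (B-·ˡ a y v)) (Unit-* (Unit-inverse xy) u)) , f) cnt) ,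
            t+k≡

        nonadjacent : ∀ x y → Vertex x → Vertex y → ¬ Unit (B x y) →
          Count Projective (λ v → Vertex v × Unit (B x v) × Unit (B y v)) (units ℕ.* r ℕ.^ N′)
          ⊎ Count Projective (λ v → Vertex v × Unit (B x v) × Unit (B y v)) (r ℕ.* r ℕ.^ N′)
        nonadjacent x y vx@(hx , Qx≈0) vy@(hy , _) xy = at (position hx hy)
          where
          at : Position x y → _
          at (independent Bxe Bye) = inj₁ ((count-classes {E = λ v → Unit (B y v)} (Unit-B-scale y)
                (count-common-independent (primitive⇒dual hx) Bxe Bye Qx≈0 (NonUnit-resp (B-sym x y) xy))))
          at (congruent x⇒y) = inj₂ ((count-cong (λ v (h , a) → h , a , x⇒y v a) (λ _ (h , a , _) → h , a)
                (regular x vx)))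

        -- The diameter is at most 2, since both possible numbers of common neighbours of
        -- non-adjacent vertices are positive.
        connected : ∀ x y → Vertex x → Vertex y → Path Vertex _~_ Adj x y
        connected x y vx vy = at (x ~? y) (Unit? (B x y))
          where
          Common : V → Set _
          Common v = Vertex v × Unit (B x v) × Unit (B y v)
          common : Count Projective Common (units ℕ.* r ℕ.^ N′) ⊎ Count Projective Common (r ℕ.* r ℕ.^ N′) → ∃ Common
          common (inj₁ h) = count-inhabited {A = Projective}
            {{ℕₚ.m*n≢0 units (r ℕ.^ N′) {{count-nonZero 1# Unit-1 count-Unit}} {{ℕₚ.m^n≢0 r N′}}}} h
          common (inj₂ h) = count-inhabited {A = Projective} {{ℕₚ.m^n≢0 r (suc N′)}} h
          via : ∃ Common → Path Vertex _~_ Adj x y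
          via (v , hv , xv , yv) = there xv hv (there (Unit-resp (B-sym y v) yv) vy (here (≋⇒~ (λ _ → refl))))
          at : Dec (x ~ y) → Dec (Unit (B x y)) → Path Vertex _~_ Adj x y
          at (yes x~y) _        = here x~y
          at (no _)    (yes xy) = there xy vy (here (≋⇒~ (λ _ → refl)))
          at (no _)    (no ¬xy) = via (common (nonadjacent x y vx vy ¬xy))

  -- The standard form as a tower of hyperbolic planes

  module Coordinates (ν δ : ℕ) (z : Carrier) (useZ : Bool) where
    open Form R ν δ z useZ
    module O = Orthogonal R ν δ z useZ
    open O using (form; N; Vector)
    open import Algebra.Properties.Semiring.Sum semiring using (sum)

    QΔ : (Fin δ → Carrier) → Carrier
    QΔ d = d ∙ (λ k → Δ k * d k)

    NonUnit-sum : ∀ {n} {g : Fin n → Carrier} → (∀ i → NonUnit (g i)) → NonUnit (sum g)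
    NonUnit-sum {zero}  _ = NonUnit-0
    NonUnit-sum {suc n} h = NonUnit-+ (h zero) (NonUnit-sum (h ∘ suc))

    QΔ-cong : ∀ {d d′} → d ≋ d′ → QΔ d ≈ QΔ d′
    QΔ-cong e = ∙-cong e (λ k → *-congˡ (e k))

    QΔ-singular : ∀ d → (∀ k → NonUnit (d k)) → NonUnit (QΔ d)
    QΔ-singular d n = NonUnit-sum (λ k → NonUnit-*ʳ _ (n k))

    module Structure (Δ-unit : ∀ k → Unit (Δ k)) (Δ-anisotropic : ∀ d → NonUnit (QΔ d) → ∀ k → NonUnit (d k)) where

      open Anisotropic δ QΔ QΔ-cong Δ-anisotropic QΔ-singular public using (tower)
      open QuadraticSet using (Point; Primitive; points)

      -- The tower stores its coordinates plane by plane, whereas `form` lists all first entries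
      -- before all second ones; these projections regroup them.
      left right : ∀ n → Point (tower n) → Fin n → Carrier
      left  (suc n) (a , b , x) = a Vector.∷ left n x
      right (suc n) (a , b , x) = b Vector.∷ right n x

      centre : ∀ n → Point (tower n) → Fin δ → Carrier
      centre zero    x           = x
      centre (suc n) (a , b , x) = centre n x

      pack : ∀ n → (Fin n → Carrier) → (Fin n → Carrier) → (Fin δ → Carrier) → Point (tower n)
      pack zero    a b d = d
      pack (suc n) a b d = a zero , b zero , pack n (a ∘ suc) (b ∘ suc) d

      left-pack : ∀ n a b d i → left n (pack n a b d) i ≈ a i
      left-pack (suc n) a b d zero    = refl
      left-pack (suc n) a b d (suc i) = left-pack n _ _ d i

      right-pack : ∀ n a b d i → right n (pack n a b d) i ≈ b i
      right-pack (suc n) a b d zero    = refl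
      right-pack (suc n) a b d (suc i) = right-pack n _ _ d i

      centre-pack : ∀ n a b d k → centre n (pack n a b d) k ≈ d k
      centre-pack zero    a b d k = refl
      centre-pack (suc n) a b d k = centre-pack n _ _ d k

      left-cong : ∀ n {x y} → Setoid._≈_ (points (tower n)) x y → left n x ≋ left n y
      left-cong (suc n) (e , f , g) zero    = e
      left-cong (suc n) (e , f , g) (suc i) = left-cong n g i

      right-cong : ∀ n {x y} → Setoid._≈_ (points (tower n)) x y → right n x ≋ right n y
      right-cong (suc n) (e , f , g) zero    = f
      right-cong (suc n) (e , f , g) (suc i) = right-cong n g i

      centre-cong : ∀ n {x y} → Setoid._≈_ (points (tower n)) x y → centre n x ≋ centre n y
      centre-cong zero    e           = e
      centre-cong (suc n) (e , f , g) = centre-cong n g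

      coordinates-injective : ∀ n {x y} → left n x ≋ left n y → right n x ≋ right n y → centre n x ≋ centre n y →
        Setoid._≈_ (points (tower n)) x y
      coordinates-injective zero    _ _ e = e
      coordinates-injective (suc n) e f g = e zero , f zero , coordinates-injective n (e ∘ suc) (f ∘ suc) g

      Q-coordinates : ∀ n x → QuadraticSet.Q (tower n) x ≈ 2# * (left n x ∙ right n x) + QΔ (centre n x)
      Q-coordinates zero    x = sym (trans (+-congʳ (zeroʳ 2#)) (+-identityˡ _))
      Q-coordinates (suc n) (a , b , x) = begin
        2# * (a * b) + QuadraticSet.Q (tower n) x                       ≈⟨ +-congˡ (Q-coordinates n x) ⟩
        2# * (a * b) + (2# * (left n x ∙ right n x) + QΔ (centre n x))
          ≈⟨ solve 3 (λ a b c → :2 :* a :+ (:2 :* b :+ c) := :2 :* (a :+ b) :+ c) refl (a * b) (left n x ∙ right n x) (QΔ (centre n x)) ⟩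
        2# * (a * b + left n x ∙ right n x) + QΔ (centre n x)           ∎

      HasUnit : ∀ {n} → (Fin n → Carrier) → Set _
      HasUnit v = ∃ λ i → Unit (v i)

      primitive⇒coordinate : ∀ n x → Primitive (tower n) x → HasUnit (left n x) ⊎ HasUnit (right n x) ⊎ HasUnit (centre n x)
      primitive⇒coordinate zero    x u = inj₂ (inj₂ u)
      primitive⇒coordinate (suc n) (a , b , x) (inj₁ u)        = inj₁ (zero , u)
      primitive⇒coordinate (suc n) (a , b , x) (inj₂ (inj₁ u)) = inj₂ (inj₁ (zero , u))
      primitive⇒coordinate (suc n) (a , b , x) (inj₂ (inj₂ h)) with primitive⇒coordinate n x h
      ... | inj₁ (i , u)        = inj₁ (suc i , u)
      ... | inj₂ (inj₁ (i , u)) = inj₂ (inj₁ (suc i , u))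
      ... | inj₂ (inj₂ h′)      = inj₂ (inj₂ h′)

      left⇒primitive : ∀ n x i → Unit (left n x i) → Primitive (tower n) x
      left⇒primitive (suc n) (a , b , x) zero    u = inj₁ u
      left⇒primitive (suc n) (a , b , x) (suc i) u = inj₂ (inj₂ (left⇒primitive n x i u))

      right⇒primitive : ∀ n x i → Unit (right n x i) → Primitive (tower n) x
      right⇒primitive (suc n) (a , b , x) zero    u = inj₂ (inj₁ u)
      right⇒primitive (suc n) (a , b , x) (suc i) u = inj₂ (inj₂ (right⇒primitive n x i u))

      centre⇒primitive : ∀ n x k → Unit (centre n x k) → Primitive (tower n) x
      centre⇒primitive zero    x           k u = k , u
      centre⇒primitive (suc n) (a , b , x) k u = inj₂ (inj₂ (centre⇒primitive n x k u))

      vector : Point (tower ν) → Vector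
      vector x = append (left ν x) (right ν x) (centre ν x)

      vector-L : ∀ x i → vector x (Lᵢ i) ≈ left ν x i
      vector-L x = append-L (left ν x) (right ν x) (centre ν x)

      vector-M : ∀ x i → vector x (Mᵢ i) ≈ right ν x i
      vector-M x = append-M (left ν x) (right ν x) (centre ν x)

      vector-D : ∀ x k → vector x (Dᵢ k) ≈ centre ν x k
      vector-D x = append-D (left ν x) (right ν x) (centre ν x)

      form-vector : ∀ x → form (vector x) (vector x) ≈ QuadraticSet.Q (tower ν) x
      form-vector x = begin
        form v v ≈⟨ form-blocks v v ⟩
        (v ∘ Lᵢ) ∙ (v ∘ Mᵢ) + (v ∘ Mᵢ) ∙ (v ∘ Lᵢ) + QΔ (v ∘ Dᵢ)
          ≈⟨ +-cong (+-cong (∙-cong (vector-L x) (vector-M x)) (trans (∙-comm (v ∘ Mᵢ) (v ∘ Lᵢ)) (∙-cong (vector-L x) (vector-M x))))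
               (∙-cong (vector-D x) (λ k → *-congˡ (vector-D x k))) ⟩
        left ν x ∙ right ν x + left ν x ∙ right ν x + QΔ (centre ν x)
          ≈⟨ +-congʳ (solve 1 (λ a → a :+ a := :2 :* a) refl (left ν x ∙ right ν x)) ⟩
        2# * (left ν x ∙ right ν x) + QΔ (centre ν x) ≈⟨ Q-coordinates ν x ⟨
        QuadraticSet.Q (tower ν) x ∎
        where v = vector x

      count-vector-image : ∀ {a b} {P : Point (tower ν) → Set a} {P′ : Vector → Set b} {n} →
        (∀ x → P x → P′ (vector x)) → (∀ x → P′ (vector x) → P x) → P′ Respects _≋_ →
        Count (points (tower ν)) P n → Count (≋-setoid N) P′ n
      count-vector-image P⇒P′ P′⇒P resp = count-map vector
        (λ {x} {y} e → ≋-blocks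
          (λ i → trans (vector-L x i) (trans (left-cong ν {x} {y} e i) (sym (vector-L y i))))
          (λ i → trans (vector-M x i) (trans (right-cong ν {x} {y} e i) (sym (vector-M y i))))
          (λ k → trans (vector-D x k) (trans (centre-cong ν {x} {y} e k) (sym (vector-D y k)))))
        P⇒P′
        (λ {x} {y} _ _ e → coordinates-injective ν
          (λ i → trans (sym (vector-L x i)) (trans (e _) (vector-L y i)))
          (λ i → trans (sym (vector-M x i)) (trans (e _) (vector-M y i)))
          (λ k → trans (sym (vector-D x k)) (trans (e _) (vector-D y k))))
        (λ v h → let x = pack ν (v ∘ Lᵢ) (v ∘ Mᵢ) (v ∘ Dᵢ)
                     v≋ = ≋-blocks {v} {vector x}
                            (λ i → sym (trans (vector-L x i) (left-pack ν _ _ (v ∘ Dᵢ) i)))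
                            (λ i → sym (trans (vector-M x i) (right-pack ν _ _ (v ∘ Dᵢ) i)))
                            (λ k → sym (trans (vector-D x k) (centre-pack ν _ _ _ k)))
                 in x , P′⇒P x (resp v≋ h) , v≋)

      primitive⇒HasUnitCoord : ∀ x → Primitive (tower ν) x → HasUnit (vector x)
      primitive⇒HasUnitCoord x h with primitive⇒coordinate ν x h
      ... | inj₁ (i , u)        = Lᵢ i , Unit-resp (sym (vector-L x i)) u
      ... | inj₂ (inj₁ (i , u)) = Mᵢ i , Unit-resp (sym (vector-M x i)) u
      ... | inj₂ (inj₂ (k , u)) = Dᵢ k , Unit-resp (sym (vector-D x k)) u

      HasUnitCoord⇒primitive : ∀ x → HasUnit (vector x) → Primitive (tower ν) x
      HasUnitCoord⇒primitive x (i , u) = at (block i) u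
        where
        at : ∀ {i} → Block i → Unit (vector x i) → Primitive (tower ν) x
        at (inL j) u = left⇒primitive ν x j (Unit-resp (vector-L x j) u)
        at (inM j) u = right⇒primitive ν x j (Unit-resp (vector-M x j) u)
        at (inD k) u = centre⇒primitive ν x k (Unit-resp (vector-D x k) u)

      form-cong : ∀ {v v′ : Vector} → v ≋ v′ → form v v ≈ form v′ v′
      form-cong {v} {v′} e = trans (form-congʳ {v} e) (trans (form-sym v v′) (form-congʳ {v′} e))

      count-singular-vectors : Count (≋-setoid N) (λ v → NonUnit (form v v)) (QuadraticSet.singular (tower ν))
      count-singular-vectors = count-vector-image
        {P = λ x → NonUnit (QuadraticSet.Q (tower ν) x)} {P′ = λ v → NonUnit (form v v)}
        (λ x → NonUnit-resp (sym (form-vector x))) (λ x → NonUnit-resp (form-vector x))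
        (λ e → NonUnit-resp (form-cong e))
        (QuadraticSet.count-singular (tower ν))

      count-vertex-vectors : Count (≋-setoid N) O.Vertex (QuadraticSet.zeros (tower ν))
      count-vertex-vectors = count-vector-image
        {P = λ x → Primitive (tower ν) x × QuadraticSet.Q (tower ν) x ≈ 0#} {P′ = O.Vertex}
        (λ x (h , e) → primitive⇒HasUnitCoord x h , trans (form-vector x) e)
        (λ x (h , e) → HasUnitCoord⇒primitive x h , trans (sym (form-vector x)) e)
        (λ e ((i , u) , f) → (i , Unit-resp (e i) u) , trans (sym (form-cong e)) f)
        (QuadraticSet.count-primitive (tower ν) 0# NonUnit-0)

      open Dual (λ k → proj₁ (Δ-unit k)) (λ k → proj₂ (Δ-unit k))

      module OrthogonalSpace (N′ : ℕ) (N≡ : N ≡ 3 ℕ.+ N′) = Vectors.BilinearSpace N N′ N≡ form (λ {u} → form-congʳ {u}) form-sym form-+ʳ form-·ʳ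
        (λ i → dualAt (block i)) (λ v i → form-dualAt v (block i))

  -- Anisotropy of the diagonal part and assembly of the graph parameters

  module Regularity (w : ℕ) (z : Carrier) (z-nonSquare : NonSquareUnit z) (useZ : Bool) where
    private
      ν : ℕ
      ν = suc (suc w)
      module F δ = Form R ν δ z useZ
      module C δ = Coordinates ν δ z useZ

    Unit-neg : ∀ {x} → Unit x → Unit (- x)
    Unit-neg {x} ux = Unit-resp (solve 1 (λ x → :- :1 :* x := :- x) refl x)
      (Unit-* (- 1# , solve 0 (:- :1 :* :- :1 := :1) refl) ux)

    Unit-if : ∀ b {x y} → Unit x → Unit y → Unit (if b then x else y)
    Unit-if true  ux _  = ux
    Unit-if false _  uy = uy

    Δ-unit : ∀ {δ} → δ ≤ 2 → ∀ k → Unit (F.Δ δ k)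
    Δ-unit {1} _ zero       = Unit-if useZ (proj₁ z-nonSquare) Unit-1
    Δ-unit {2} _ zero       = Unit-1
    Δ-unit {2} _ (suc zero) = Unit-neg (proj₁ z-nonSquare)
    Δ-unit {suc (suc (suc _))} (s≤s (s≤s ()))

    -- If `y` had an inverse `a`, then `z` would be congruent to `(x a)^2` modulo `π`, and
    -- `lift-square` would make it a square in the ring. Once `y` is a non-unit, so is `x * x`.
    norm-anisotropic : ∀ {x y} → NonUnit (x * x - z * (y * y)) → NonUnit x × NonUnit y
    norm-anisotropic {x} {y} n = (λ ux → x*x (Unit-* ux ux)) , y-nonUnit
      where
      y-nonUnit : NonUnit y
      y-nonUnit (a , ya≈1) = proj₂ z-nonSquare (lift-square unit-xa z-xa²)
        where
        z-xa² : NonUnit (z - x * a * (x * a))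
        z-xa² = NonUnit-resp (begin
          - (a * a) * (x * x - z * (y * y))
            ≈⟨ solve 4 (λ a x y z → :- (a :* a) :* (x :* x :- z :* (y :* y)) := z :* ((y :* a) :* (y :* a)) :- x :* a :* (x :* a)) refl a x y z ⟩
          z * ((y * a) * (y * a)) - x * a * (x * a)
            ≈⟨ +-congʳ (*-congˡ (*-cong ya≈1 ya≈1)) ⟩
          z * (1# * 1#) - x * a * (x * a)
            ≈⟨ solve 2 (λ z b → z :* (:1 :* :1) :- b := z :- b) refl z (x * a * (x * a)) ⟩
          z - x * a * (x * a) ∎) (NonUnit-*ˡ _ n)
        -- `lift-square` starts from a unit; `(x a)^2` is one because it differs from the unit `z`
        -- by a non-unit.
        unit-xa : Unit (x * a)
        unit-xa = Unit-factorˡ (Unit-resp (solve 2 (λ z b → z :+ :- (z :- b) := b) refl z (x * a * (x * a)))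
          (Unit+NonUnit (proj₁ z-nonSquare) (NonUnit-neg z-xa²)))
      x*x : NonUnit (x * x)
      x*x = NonUnit-+-cancelʳ (NonUnit-neg (NonUnit-*ˡ z (NonUnit-*ˡ y y-nonUnit))) n

    Δ-anisotropic : ∀ {δ} (δ≤2 : δ ≤ 2) d → NonUnit (C.QΔ δ d) → ∀ k → NonUnit (d k)
    Δ-anisotropic {1} δ≤2 d n zero ud = n (Unit-resp (sym (+-identityʳ _)) (Unit-* ud (Unit-* (Δ-unit δ≤2 zero) ud)))
    Δ-anisotropic {2} _ d n = λ { zero → proj₁ both ; (suc zero) → proj₂ both }
      where
      both : NonUnit (d zero) × NonUnit (d (suc zero))
      both = norm-anisotropic (NonUnit-resp
        (solve 3 (λ x y z → x :* (:1 :* x) :+ (y :* (:- z :* y) :+ :0) := x :* x :- z :* (y :* y)) refl (d zero) (d (suc zero)) z) n)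
    Δ-anisotropic {suc (suc (suc _))} (s≤s (s≤s ()))

    module _ {δ : ℕ} (δ≤2 : δ ≤ 2) (m≥1 : m ≥ 1) where
      private
        u : ℕ
        u = p ℕ.^ m ℕ.∸ 1

        p^m≡ : p ℕ.^ m ≡ suc u
        p^m≡ = ≡.sym (ℕₚ.m+[n∸m]≡n (ℕₚ.m^n>0 p m))

        q≡ : q ≡ suc u
        q≡ = ≡.trans q≡p^m p^m≡

        nonUnits≡ : nonUnits ≡ suc u ℕ.^ s′
        nonUnits≡ = ≡.cong (ℕ._^ s′) q≡

        r≡ : r ≡ suc u ℕ.^ s
        r≡ = ≡.cong (ℕ._^ s) q≡

        r≡q*nonUnits : r ≡ suc u ℕ.* nonUnits
        r≡q*nonUnits = ≡.cong (ℕ._* nonUnits) q≡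

        units≡ : units ≡ u ℕ.* nonUnits
        units≡ = ℕₚ.+-cancelˡ-≡ nonUnits _ _ (≡.trans nonUnits+units r≡q*nonUnits)

        -- Chosen so that `suc N′` is definitionally `2 * suc w + δ`, the rank after one hyperbolic
        -- plane is removed.
        N′ : ℕ
        N′ = w ℕ.+ suc (w ℕ.+ 0) ℕ.+ δ

        N≡ : 2 ℕ.* ν ℕ.+ δ ≡ 3 ℕ.+ N′
        N≡ = ≡.cong (ℕ._+ δ) (double-suc (suc w))

        open C.Structure δ (Δ-unit δ≤2) (Δ-anisotropic δ≤2)
        open C.Structure.OrthogonalSpace δ (Δ-unit δ≤2) (Δ-anisotropic δ≤2) N′ N≡
        open QuadraticSet using (size; singular; zeros)

        open TowerCounts u δ nonUnits r units r≡q*nonUnits units≡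
          (λ n → size (tower n)) (λ n → singular (tower n)) (λ n → zeros (tower n))
          ≡.refl (λ _ → ≡.refl) ≡.refl (λ _ → ≡.refl) ≡.refl (λ _ → ≡.refl)
        open ResidueCounts u δ using (t; y)
        open Parameters p m u s′ w p^m≡ using (nParam≡; kParam≡; lamParam≡; c₁Param≡; c₁≢c₂)

        t₁ : ℕ
        t₁ = singular (tower (suc w))

        Singular : Orthogonal.Vector R ν δ z useZ → Set _
        Singular v = NonUnit (Orthogonal.form R ν δ z useZ v v)

        -- `tower ν` is by definition one plane on top of `tower (suc w)`, so its number of singular
        -- vectors already has the shape that `Graph` expects, up to `size≡`.
        count-singular : Count (≋-setoid (2 ℕ.* ν ℕ.+ δ)) Singular
          (units ℕ.* (r ℕ.* r ℕ.^ N′) ℕ.* nonUnits ℕ.+ nonUnits ℕ.* (r ℕ.* t₁))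
        count-singular = ≡.subst (λ e → Count (≋-setoid (2 ℕ.* ν ℕ.+ δ)) Singular (units ℕ.* e ℕ.* nonUnits ℕ.+ nonUnits ℕ.* (r ℕ.* t₁)))
          (size≡ (suc w)) count-singular-vectors

        module G = Graph t₁ count-singular

        k≡ : r ℕ.* r ℕ.^ N′ ≡ kParam p s m ν δ
        k≡ = ≡.trans (≡.cong (ℕ._^ suc N′) r≡) (≡.sym (kParam≡ δ))

        c₁≡ : units ℕ.* r ℕ.^ N′ ≡ c₁Param p s m ν δ
        c₁≡ = ≡.trans (≡.cong₂ (λ a b → a ℕ.* b ℕ.^ N′) (≡.trans units≡ (≡.cong (u ℕ.*_) nonUnits≡)) r≡) (≡.sym (c₁Param≡ δ))

        t₁≡ : t₁ ≡ (suc u ℕ.^ s′) ℕ.^ suc N′ ℕ.* t (suc w)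
        t₁≡ = ≡.trans (singular≡ (suc w)) (≡.cong (λ P → P ℕ.^ suc N′ ℕ.* t (suc w)) nonUnits≡)

        λ≡ : ∀ {k} → t₁ ℕ.+ k ≡ r ℕ.* r ℕ.^ N′ → k ≡ lamParam p s m ν δ
        λ≡ {k} e = ℕₚ.+-cancelˡ-≡ t₁ _ _ (≡.trans e (≡.trans (≡.cong (ℕ._^ suc N′) r≡)
          (≡.sym (≡.trans (≡.cong (ℕ._+ lamParam p s m ν δ) t₁≡) (lamParam≡ δ≤2)))))

        n≡ : ∀ {n} → n ℕ.* units ≡ zeros (tower ν) → n ≡ nParam p s m ν δ p-prime m≥1
        n≡ {n} e = ≡.trans (ℕₚ.*-cancelʳ-≡ n (nonUnits ℕ.^ suc N′ ℕ.* y ν) units {{count-nonZero 1# Unit-1 count-Unit}}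
            (≡.trans e (zeros≡ (suc w))))
          (≡.trans (≡.cong (λ P → P ℕ.^ suc N′ ℕ.* y ν) nonUnits≡) (≡.sym (nParam≡ δ p-prime m≥1)))

        module O = Orthogonal R ν δ z useZ

        Common : O.Vector → O.Vector → O.Vector → Set _
        Common x y v = O.Vertex v × O.Adj x v × O.Adj y v

        order : HasCount O._~_ O.Vertex (nParam p s m ν δ p-prime m≥1)
        order = relabel (count-vertices count-vertex-vectors)
          where
          relabel : (∃ λ n → Count Projective O.Vertex n × n ℕ.* units ≡ zeros (tower ν)) →
            HasCount O._~_ O.Vertex (nParam p s m ν δ p-prime m≥1)
          relabel (n , mkCount cnt , e) = ≡.subst (HasCount O._~_ O.Vertex) (n≡ e) cnt

        regular : ∀ x → O.Vertex x → HasCount O._~_ (λ y → O.Vertex y × O.Adj x y) (kParam p s m ν δ)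
        regular x vx = ≡.subst (HasCount O._~_ (λ y → O.Vertex y × O.Adj x y)) k≡ (Count.hasCount (G.regular x vx))

        adjacent : ∀ x y → O.Vertex x → O.Vertex y → O.Adj x y → HasCount O._~_ (Common x y) (lamParam p s m ν δ)
        adjacent x y vx vy xy = relabel (G.adjacent x y vx vy xy)
          where
          relabel : (∃ λ k → Count Projective (Common x y) k × t₁ ℕ.+ k ≡ r ℕ.* r ℕ.^ N′) →
            HasCount O._~_ (Common x y) (lamParam p s m ν δ)
          relabel (k , mkCount cnt , e) = ≡.subst (HasCount O._~_ (Common x y)) (λ≡ e) cnt

        nonadjacent : ∀ x y → O.Vertex x → O.Vertex y → ¬ O.Adj x y →
          HasCount O._~_ (Common x y) (c₁Param p s m ν δ) ⊎ HasCount O._~_ (Common x y) (c₂Param p s m ν δ)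
        nonadjacent x y vx vy xy = relabel (G.nonadjacent x y vx vy xy)
          where
          relabel : Count Projective (Common x y) (units ℕ.* r ℕ.^ N′) ⊎ Count Projective (Common x y) (r ℕ.* r ℕ.^ N′) →
            HasCount O._~_ (Common x y) (c₁Param p s m ν δ) ⊎ HasCount O._~_ (Common x y) (c₂Param p s m ν δ)
          relabel (inj₁ (mkCount cnt)) = inj₁ (≡.subst (HasCount O._~_ (Common x y)) c₁≡ cnt)
          relabel (inj₂ (mkCount cnt)) = inj₂ (≡.subst (HasCount O._~_ (Common x y)) k≡ cnt)

      quasiStronglyRegular : QuasiStronglyRegular
        (Orthogonal.Vertex R ν δ z useZ) (Orthogonal._~_ R ν δ z useZ) (Orthogonal.Adj R ν δ z useZ)
        (nParam p s m ν δ p-prime m≥1) (kParam p s m ν δ) (lamParam p s m ν δ) (c₁Param p s m ν δ) (c₂Param p s m ν δ)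
      quasiStronglyRegular = record
        { c-distinct  = c₁≢c₂ δ
        ; order       = order
        ; connected   = G.connected
        ; regular     = regular
        ; adjacent    = λ x y vx vy _ → adjacent x y vx vy
        ; nonadjacent = λ x y vx vy _ → nonadjacent x y vx vy
        }

theorem3p4 : ∀ {c ℓ} (R : CommutativeRing c ℓ) (p s m ν δ : ℕ)
    (p-prime : Prime p) → p ≢ 2 → s ≥ 2 → (m≥1 : m ≥ 1) →
    RingNotions.GaloisRing R p s m →
    ν ≥ 2 → δ ≤ 2 →
    (z : CommutativeRing.Carrier R) → RingNotions.NonSquareUnit R z →
    (useZ : Bool) →
    QuasiStronglyRegular
    (Orthogonal.Vertex R ν δ z useZ)
    (Orthogonal._~_ R ν δ z useZ)
    (Orthogonal.Adj R ν δ z useZ)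
    (nParam p s m ν δ p-prime m≥1)
    (kParam p s m ν δ)
    (lamParam p s m ν δ)
    (c₁Param p s m ν δ)
    (c₂Param p s m ν δ)
theorem3p4 R p (suc s′) m (suc (suc w)) δ p-prime p≢2 (s≤s _) m≥1 galois (s≤s (s≤s _)) δ≤2 z z-nonSquare useZ =
  OverGaloisRing.Regularity.quasiStronglyRegular R p s′ m p-prime p≢2 galois w z z-nonSquare useZ δ≤2 m≥1
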